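{- Let $R$ be a ring, $\tau\in\mathbf{M}_{\mathrm{stab}}(R)$, $a\in\mathbf{G}(R)$ and $y\in\mathbf{X}_{\tau,a}(R)$. Then there are unique $(h,b)\in\mathbf{H}(R)\times\mathbf{G}_\tau(R)$ with $ay=hb$, and the following are equivalent: (i) $\mathbf{X}_{\tau,a}$ is tangential at $y$ over $R$; (ii) $b^2\in\mathbf{Z}(R)$.
   Context: Rings are commutative with $1$. Let $\mathbf{V}$ be a free $\mathbb{Z}$-module of finite rank, $\mathbf{V}^*=\mathrm{Hom}(\mathbf{V},\mathbb{Z})$; fix $e\in\mathbf{V}$, $e^*\in\mathbf{V}^*$ with $e^*(e)=1$. For a ring $R$: $\mathbf{V}(R)=\mathbf{V}\otimes R$, $\mathbf{V}^*(R)=\mathrm{Hom}_R(\mathbf{V}(R),R)$, $\mathbf{M}(R)=\mathrm{End}_R(\mathbf{V}(R))$, $\mathbf{G}(R)=\mathrm{Aut}_R(\mathbf{V}(R))$, $\mathbf{Z}(R)=R^\times$ (scalars). Juxtaposition: $\ell v=\ell(v)$, $xv=x(v)$, $\ell x=\ell\circ x$, $v\ell=(u\mapsto\ell(u)v)$. $\mathbf{V}_H(R)=\{v:e^*v=0\}$, $1_H=1-ee^*$, $\mathbf{M}_H(R)=\mathrm{End}_R(\mathbf{V}_H(R))$ (extended by $0$ on $Re$), $\mathbf{H}(R)=\mathrm{Aut}_R(\mathbf{V}_H(R))$ acting trivially on $Re$ (i.e. $\{g\in\mathbf{G}(R):ge=e,\ e^*g=e^*\}$), $\tau_H=1_H\tau1_H$.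 For an $R$-algebra $R'$: $\mathbf{G}_\tau(R')$ = centralizer of $\tau$ in $\mathbf{G}(R')$; $\mathbf{H}_\sigma(R')$ = centralizer of $\sigma\in\mathbf{M}_H(R)$ in $\mathbf{H}(R')$. $v$ (resp. $\ell$) is $\tau$-cyclic if $R[\tau]v=\mathbf{V}(R)$ (resp. $\ell R[\tau]=\mathbf{V}^*(R)$); $\tau$ is stable if $e$ and $e^*$ are $\tau$-cyclic; $\mathbf{M}_{\mathrm{stab}}(R)$ = stable elements. For $\tau$ stable, $a\in\mathbf{G}(R)$: $\mathbf{X}_{\tau,a}(R')=\{y\in\mathbf{H}_{\tau_H}(R'): ay\in\mathbf{H}(R')\mathbf{G}_\tau(R')\}$. Let $R'=R[\varepsilon]/(\varepsilon^2)$ with the map $R'\to R$, $\varepsilon\mapsto0$. For $y\in\mathbf{X}_{\tau,a}(R)$, $\mathbf{X}_{\tau,a}$ is tangential at $y$ over $R$ if every $y'\in\mathbf{H}_{\tau_H}(R')$ mapping to $y$ under $\mathbf{H}_{\tau_H}(R')\to\mathbf{H}_{\tau_H}(R)$ lies in $\mathbf{X}_{\tau,a}(R')$. -}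

module Defs where

open import Level using (Level; _⊔_)
open import Data.Nat using (ℕ; zero; suc)
open import Data.Integer using (ℤ; +_; -[1+_])
open import Data.Fin using (Fin; zero; suc; _≟_)
open import Data.List using (List; []; _∷_)
open import Data.Product using (Σ; _×_; _,_; proj₁; proj₂)
open import Relation.Nullary using (yes; no)
open import Algebra.Bundles using (CommutativeRing)
open import Algebra.Bundles.Raw using (RawRing)

sumℤ : ∀ {m} → (Fin m → ℤ) → ℤ
sumℤ {zero}  f = + 0
sumℤ {suc m} f = f zero Data.Integer.+ sumℤ (λ i → f (suc i))

-- e*(e) in ℤ, for e, e* given by coordinates in a fixed ℤ-basis of V ≅ ℤⁿ
pairℤ : ∀ {n} → (Fin n → ℤ) → (Fin n → ℤ) → ℤ
pairℤ ℓ v = sumℤ (λ i → ℓ i Data.Integer.* v i)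

-- Linear algebra on V(R) = Rⁿ for a ring R.  All notions only use the
-- ring operations, so they are defined over a RawRing; this lets us
-- apply them both to R and to R' = R[ε]/(ε²).

module Lin {c ℓ : Level} (R : RawRing c ℓ) (n : ℕ) (e e* : Fin n → ℤ) where
  open RawRing R

  Vec : Set c
  Vec = Fin n → Carrier

  Mat : Set c
  Mat = Fin n → Fin n → Carrier

  _≈V_ : Vec → Vec → Set ℓ
  v ≈V w = ∀ i → v i ≈ w i

  _≈M_ : Mat → Mat → Set ℓ
  A ≈M B = ∀ i j → A i j ≈ B i j

  sumF : ∀ {m} → (Fin m → Carrier) → Carrier
  sumF {zero}  f = 0#
  sumF {suc m} f = f zero + sumF (λ i → f (suc i))

  natR : ℕ → Carrier
  natR zero    = 0#
  natR (suc k) = 1# + natR k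

  fromℤ : ℤ → Carrier
  fromℤ (+ k)      = natR k
  fromℤ -[1+ k ]   = - natR (suc k)

  δ : Fin n → Fin n → Carrier
  δ i j with i ≟ j
  ... | yes _ = 1#
  ... | no  _ = 0#

  I : Mat
  I = δ

  0M : Mat
  0M i j = 0#

  scal : Carrier → Mat
  scal r i j = r * δ i j

  _·_ : Mat → Mat → Mat
  (A · B) i j = sumF (λ k → A i k * B k j)

  _⊕_ : Mat → Mat → Mat
  (A ⊕ B) i j = A i j + B i j

  _⊖_ : Mat → Mat → Mat
  (A ⊖ B) i j = A i j + (- B i j)

  _◃_ : Mat → Vec → Vec
  (A ◃ v) i = sumF (λ k → A i k * v k)

  -- ℓ x   (covectors as coordinate rows in the dual basis)
  _▹_ : Vec → Mat → Vec
  (l ▹ A) j = sumF (λ k → l k * A k j)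

  outer : Vec → Vec → Mat
  outer v l i j = v i * l j

  eR : Vec
  eR i = fromℤ (e i)

  e*R : Vec
  e*R i = fromℤ (e* i)

  1H : Mat
  1H = I ⊖ outer eR e*R

  τH : Mat → Mat
  τH τ = 1H · (τ · 1H)

  IsG : Mat → Set (c ⊔ ℓ)
  IsG g = Σ Mat λ g' → (g · g') ≈M I × (g' · g) ≈M I

  IsH : Mat → Set (c ⊔ ℓ)
  IsH g = IsG g × (g ◃ eR) ≈V eR × (e*R ▹ g) ≈V e*R

  Commutes : Mat → Mat → Set ℓ
  Commutes σ g = (g · σ) ≈M (σ · g)

  IsGτ : Mat → Mat → Set (c ⊔ ℓ)
  IsGτ τ g = IsG g × Commutes τ g

  IsHσ : Mat → Mat → Set (c ⊔ ℓ)
  IsHσ σ g = IsH g × Commutes σ g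

  IsZ : Mat → Set (c ⊔ ℓ)
  IsZ g = Σ Carrier λ r → (Σ Carrier λ r' → (r * r') ≈ 1#) × g ≈M scal r

  evalPoly : List Carrier → Mat → Mat
  evalPoly []       τ = 0M
  evalPoly (r ∷ rs) τ = scal r ⊕ (τ · evalPoly rs τ)

  Cyclic : Mat → Vec → Set (c ⊔ ℓ)
  Cyclic τ v = ∀ w → Σ (List Carrier) λ p → (evalPoly p τ ◃ v) ≈V w

  CoCyclic : Mat → Vec → Set (c ⊔ ℓ)
  CoCyclic τ l = ∀ w → Σ (List Carrier) λ p → (l ▹ evalPoly p τ) ≈V w

  Stable : Mat → Set (c ⊔ ℓ)
  Stable τ = Cyclic τ eR × CoCyclic τ e*R

  IsX : Mat → Mat → Mat → Set (c ⊔ ℓ)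
  IsX τ a y = IsHσ (τH τ) y ×
    Σ Mat λ h → Σ Mat λ b → IsH h × IsGτ τ b × (a · y) ≈M (h · b)

-- Dual numbers R' = R[ε]/(ε²) : pairs (x , x') standing for x + ε x'.

Dual : ∀ {c ℓ} → RawRing c ℓ → RawRing c ℓ
Dual R = record
  { Carrier = Carrier × Carrier
  ; _≈_ = λ x y → (proj₁ x ≈ proj₁ y) × (proj₂ x ≈ proj₂ y)
  ; _+_ = λ x y → (proj₁ x + proj₁ y , proj₂ x + proj₂ y)
  ; _*_ = λ x y → (proj₁ x * proj₁ y , (proj₁ x * proj₂ y) + (proj₂ x * proj₁ y))
  ; -_ = λ x → (- proj₁ x , - proj₂ x)
  ; 0# = (0# , 0#)
  ; 1# = (1# , 0#)
  }
  where open RawRing R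

module Tangent {c ℓ : Level} (R : CommutativeRing c ℓ) (n : ℕ) (e e* : Fin n → ℤ) where
  open CommutativeRing R using (rawRing; 0#)
  open Lin rawRing n e e* public
  module D = Lin (Dual rawRing) n e e*

  ι : Mat → D.Mat
  ι A i j = (A i j , 0#)

  π : D.Mat → Mat
  π A i j = proj₁ (A i j)

  Tangential : Mat → Mat → Mat → Set (c ⊔ ℓ)
  Tangential τ a y =
    ∀ (y' : D.Mat) → D.IsHσ (ι (τH τ)) y' → π y' ≈M y → D.IsX (ι τ) (ι a) y'

{-# OPTIONS --safe #-}
-- Work in the ring M = End(V) with the idempotent p = e e* and q = 1 − p, so that τ_H = q τ q.
-- Identities between vectors x e become identities x p, those between covectors e* x become p x.
-- Since e is τ-cyclic, every vector is S e for a unique S commuting with τ, and such S commute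
-- with one another; B(S e, S' e) = e* S S' e is then a symmetric form for which τ, p and all
-- polynomials in τ_H are self-adjoint, and it is nondegenerate because e* is τ-cyclic.
--
-- A tangent vector y + ε y u at y lies in X iff b u b⁻¹ ∈ Lie(H) + Lie(G_τ), that is, iff some s
-- commuting with τ satisfies u b⁻¹ e = s b⁻¹ e and e* b u = e* b s.  Here u is a polynomial in τ_H
-- times q, hence self-adjoint, and the second equation is equivalent to u b e = s b e.  If b² is a
-- scalar, both equations say the same and s exists by cyclicity.  Conversely they imply
-- b² u b⁻¹ e = u b² b⁻¹ e.  For u = q this gives (e* b⁻¹ e) b² e ∈ R e; for u and τ_H u it gives
-- (e* τ u b⁻¹ e) b² e ∈ R e.  Writing b e = c e + u τ e with u as above, the relation
-- 1 = e* b⁻¹ b e = c (e* b⁻¹ e) + e* τ u b⁻¹ e shows b² e ∈ R e, so b² is a scalar.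
module Submission where

open import Defs
open import Level using (Level; _⊔_)
open import Data.Nat as ℕ using (ℕ; zero; suc)
open import Data.Integer as ℤ using (ℤ; +_; -[1+_])
import Data.Integer.Properties as ℤ
import Data.Sign as Sign
open import Data.Fin as Fin using (Fin; zero; suc)
import Data.Fin.Properties as Fin
open import Data.List using ([]; _∷_)
open import Data.Product using (Σ; _×_; _,_; proj₁; proj₂)
open import Function.Base using (_∘_)
open import Function.Bundles using (_⇔_; mk⇔)
open import Relation.Nullary using (yes; no; contradiction)
open import Relation.Binary.PropositionalEquality as ≡ using (_≡_; _≢_)
open import Algebra.Bundles using (CommutativeRing; Ring)
import Algebra.Properties.CommutativeSemigroup as CommutativeSemigroupProperties
import Algebra.Properties.Ring as RingProperties
import Relation.Binary.Reasoning.Setoid as SetoidReasoning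

-- Noncommutative rings

module RingLemmas {m ℓ} (M : Ring m ℓ) where
  open Ring M
  open RingProperties M using (-‿distribˡ-*; -‿distribʳ-*)
  open SetoidReasoning setoid

  pullˡ : ∀ {a b c} → a * b ≈ c → ∀ x → a * (b * x) ≈ c * x
  pullˡ eq x = trans (sym (*-assoc _ _ x)) (*-congʳ eq)

  swapˡ : ∀ {a b} → a * b ≈ b * a → ∀ x → a * (b * x) ≈ b * (a * x)
  swapˡ eq x = trans (pullˡ eq x) (*-assoc _ _ x)

  *-comm-closed : ∀ {a b c} → a * c ≈ c * a → b * c ≈ c * b → (a * b) * c ≈ c * (a * b)
  *-comm-closed {a} {b} {c} ac bc = begin
    (a * b) * c  ≈⟨ *-assoc a b c ⟩
    a * (b * c)  ≈⟨ *-congˡ bc ⟩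
    a * (c * b)  ≈⟨ swapˡ ac b ⟩
    c * (a * b)  ∎

  +-comm-closed : ∀ {a b c} → a * c ≈ c * a → b * c ≈ c * b → (a + b) * c ≈ c * (a + b)
  +-comm-closed {a} {b} {c} ac bc = begin
    (a + b) * c    ≈⟨ distribʳ c a b ⟩
    a * c + b * c  ≈⟨ +-cong ac bc ⟩
    c * a + c * b  ≈⟨ distribˡ c a b ⟨
    c * (a + b)    ∎

  IsInverse : Carrier → Carrier → Set ℓ
  IsInverse g g⁻ = g * g⁻ ≈ 1# × g⁻ * g ≈ 1#

  cancelˡ : ∀ {g g⁻} → g⁻ * g ≈ 1# → ∀ x → g⁻ * (g * x) ≈ x
  cancelˡ inv x = trans (pullˡ inv x) (*-identityˡ x)

  inverse-comm : ∀ {g g⁻ x} → IsInverse g g⁻ → g * x ≈ x * g → g⁻ * x ≈ x * g⁻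
  inverse-comm {g} {g⁻} {x} (r , l) gx = begin
    g⁻ * x               ≈⟨ *-congˡ (trans (*-congˡ r) (*-identityʳ x)) ⟨
    g⁻ * (x * (g * g⁻))  ≈⟨ *-congˡ (*-assoc x g g⁻) ⟨
    g⁻ * ((x * g) * g⁻)  ≈⟨ *-congˡ (*-congʳ gx) ⟨
    g⁻ * ((g * x) * g⁻)  ≈⟨ *-congˡ (*-assoc g x g⁻) ⟩
    g⁻ * (g * (x * g⁻))  ≈⟨ cancelˡ l _ ⟩
    x * g⁻               ∎

  inverse-fixˡ : ∀ {g g⁻ x} → IsInverse g g⁻ → g * x ≈ x → g⁻ * x ≈ x
  inverse-fixˡ (r , l) gx = trans (*-congˡ (sym gx)) (cancelˡ l _)

  inverse-fixʳ : ∀ {g g⁻ x} → IsInverse g g⁻ → x * g ≈ x → x * g⁻ ≈ x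
  inverse-fixʳ {g} {g⁻} {x} (r , l) xg = begin
    x * g⁻        ≈⟨ *-congʳ xg ⟨
    (x * g) * g⁻  ≈⟨ *-assoc x g g⁻ ⟩
    x * (g * g⁻)  ≈⟨ *-congˡ r ⟩
    x * 1#        ≈⟨ *-identityʳ x ⟩
    x             ∎

  -- The ε-parts of (g + ε d)(g⁻¹ − ε g⁻¹ d g⁻¹) and of the product in the other order.
  dual-inverse : ∀ {g g⁻} → IsInverse g g⁻ → ∀ d →
    g * - (g⁻ * (d * g⁻)) + d * g⁻ ≈ 0# × g⁻ * d + - (g⁻ * (d * g⁻)) * g ≈ 0#
  dual-inverse {g} {g⁻} (r , l) d = (begin
    g * - (g⁻ * (d * g⁻)) + d * g⁻    ≈⟨ +-congʳ (-‿distribʳ-* g _) ⟨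
    - (g * (g⁻ * (d * g⁻))) + d * g⁻  ≈⟨ +-congʳ (-‿cong (cancelˡ r _)) ⟩
    - (d * g⁻) + d * g⁻               ≈⟨ -‿inverseˡ _ ⟩
    0#                                ∎) , (begin
    g⁻ * d + - (g⁻ * (d * g⁻)) * g    ≈⟨ +-congˡ (-‿distribˡ-* _ g) ⟨
    g⁻ * d - (g⁻ * (d * g⁻)) * g      ≈⟨ +-congˡ (-‿cong (*-congʳ (*-assoc g⁻ d g⁻))) ⟨
    g⁻ * d - ((g⁻ * d) * g⁻) * g      ≈⟨ +-congˡ (-‿cong (trans (*-assoc _ g⁻ g) (trans (*-congˡ l) (*-identityʳ _)))) ⟩
    g⁻ * d - g⁻ * d                   ≈⟨ -‿inverseʳ _ ⟩
    0#                                ∎)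

-- Polynomials in a ring element with central coefficients

module Polynomials {m ℓ k} (M : Ring m ℓ) (K : Ring.Carrier M → Set k)
  (K-central : ∀ {z} → K z → ∀ x → Ring._≈_ M (Ring._*_ M z x) (Ring._*_ M x z)) where
  open Ring M
  open RingLemmas M
  open SetoidReasoning setoid

  -- Horner form, closed under `≈`. The value of the polynomial is the index, so an induction over
  -- `Poly` speaks about the ring element itself.
  data Poly (σ : Carrier) : Carrier → Set (m ⊔ ℓ ⊔ k) where
    nil  : ∀ {P} → P ≈ 0# → Poly σ P
    step : ∀ {z P P'} → K z → Poly σ P → P' ≈ z + σ * P → Poly σ P'

  poly-comm : ∀ {σ P x} → Poly σ P → x * σ ≈ σ * x → P * x ≈ x * P
  poly-comm {σ} {P} {x} (nil eq) _ = begin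
    P * x   ≈⟨ *-congʳ eq ⟩
    0# * x  ≈⟨ zeroˡ x ⟩
    0#      ≈⟨ zeroʳ x ⟨
    x * 0#  ≈⟨ *-congˡ eq ⟨
    x * P   ∎
  poly-comm {σ} {P'} {x} (step {z} {P} Kz pol eq) xσ = begin
    P' * x           ≈⟨ *-congʳ eq ⟩
    (z + σ * P) * x  ≈⟨ +-comm-closed (K-central Kz x) (*-comm-closed (sym xσ) (poly-comm pol xσ)) ⟩
    x * (z + σ * P)  ≈⟨ *-congˡ eq ⟨
    x * P'           ∎

-- M is End(V), K its scalars and p = e e*, so that p x p = (e* x e) p.
record StableEndomorphism {m ℓ} (M : Ring m ℓ) (k : Level) : Set (m ⊔ ℓ ⊔ Level.suc k) where
  open Ring M
  field
    K         : Carrier → Set k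
    K-central : ∀ {z} → K z → ∀ x → z * x ≈ x * z
    K-0       : K 0#
    K-+       : ∀ {x y} → K x → K y → K (x + y)
    K-*       : ∀ {x y} → K x → K y → K (x * y)
  open Polynomials M K K-central public
  field
    p         : Carrier
    pp        : p * p ≈ p
    corner    : ∀ x → Σ Carrier λ z → K z × p * (x * p) ≈ z * p
    faithfulˡ : ∀ {x y} → (∀ w → x * (w * p) ≈ y * (w * p)) → x ≈ y
    faithfulʳ : ∀ {x y} → (∀ w → (p * w) * x ≈ (p * w) * y) → x ≈ y
    τ         : Carrier
    cyclic    : ∀ w → Σ Carrier λ P → Poly τ P × P * p ≈ w * p
    cocyclic  : ∀ w → Σ Carrier λ P → Poly τ P × p * P ≈ p * w

-- The centralizer of a stable `τ` and the symmetric form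

module StableElement {m ℓ k} {M : Ring m ℓ} (stable : StableEndomorphism M k) where
  open Ring M
  open StableEndomorphism stable
  open RingLemmas M
  open RingProperties M using (-‿distribˡ-*; -‿distribʳ-*; x[y-z]≈xy-xz; [y-z]x≈yx-zx; +-cancelˡ)
  open CommutativeSemigroupProperties +-commutativeSemigroup using (interchange)
  open SetoidReasoning setoid

  q : Carrier
  q = 1# - p

  σ : Carrier
  σ = q * (τ * q)

  -- The centralizer in the whole ring, units or not: its units form G_τ, and it is also the Lie
  -- algebra of G_τ.
  C : Carrier → Set ℓ
  C x = x * τ ≈ τ * x

  K⇒C : ∀ {z} → K z → C z
  K⇒C Kz = K-central Kz τ

  poly⇒C : ∀ {P} → Poly τ P → C P
  poly⇒C pol = poly-comm pol refl

  -- By cyclicity every vector is P e with P a polynomial in `τ`. Both x and y commute with P, so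
  -- agreement at e spreads to all vectors.
  C-unique : ∀ {x y} → C x → C y → x * p ≈ y * p → x ≈ y
  C-unique {x} {y} Cx Cy eq = faithfulˡ λ w → let (P , pol , Pp) = cyclic w in begin
    x * (w * p)  ≈⟨ *-congˡ Pp ⟨
    x * (P * p)  ≈⟨ swapˡ (poly-comm pol Cx) p ⟨
    P * (x * p)  ≈⟨ *-congˡ eq ⟩
    P * (y * p)  ≈⟨ swapˡ (poly-comm pol Cy) p ⟩
    y * (P * p)  ≈⟨ *-congˡ Pp ⟩
    y * (w * p)  ∎

  C-counique : ∀ {x y} → C x → C y → p * x ≈ p * y → x ≈ y
  C-counique {x} {y} Cx Cy eq = faithfulʳ λ w → let (P , pol , pP) = cocyclic w in begin
    (p * w) * x  ≈⟨ *-congʳ pP ⟨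
    (p * P) * x  ≈⟨ *-assoc p P x ⟩
    p * (P * x)  ≈⟨ *-congˡ (poly-comm pol Cx) ⟩
    p * (x * P)  ≈⟨ pullˡ eq P ⟩
    (p * y) * P  ≈⟨ *-assoc p y P ⟩
    p * (y * P)  ≈⟨ *-congˡ (poly-comm pol Cy) ⟨
    p * (P * y)  ≈⟨ *-assoc p P y ⟨
    (p * P) * y  ≈⟨ *-congʳ pP ⟩
    (p * w) * y  ∎

  -- By cyclicity y agrees at e with a polynomial in `τ`, hence equals it by `C-unique`; x commutes
  -- with such polynomials.
  C-comm : ∀ {x y} → C x → C y → x * y ≈ y * x
  C-comm {x} {y} Cx Cy = let (P , pol , Pp) = cyclic y
                             y≈P = C-unique Cy (poly⇒C pol) (sym Pp) in begin
    x * y  ≈⟨ *-congˡ y≈P ⟩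
    x * P  ≈⟨ poly-comm pol Cx ⟨
    P * x  ≈⟨ *-congʳ y≈P ⟨
    y * x  ∎

  -- Turns vectors into operators: a vector w e becomes T e with T in the centralizer, so that it
  -- can be an argument of the form B.
  orbit : ∀ w → Σ Carrier λ T → C T × T * p ≈ w * p
  orbit w = let (P , pol , Pp) = cyclic w in P , poly⇒C pol , Pp

  -- The symmetric form B(S e, S' e) = e* S S' e (S, S' in the centralizer of τ) makes τ self-adjoint;
  -- Adj x x' says that x' is the adjoint of x for B.
  Adj : Carrier → Carrier → Set (m ⊔ ℓ)
  Adj x x' = ∀ {S S'} → C S → C S' → p * (S * (x * (S' * p))) ≈ p * (S' * (x' * (S * p)))

  adj-cong : ∀ {x y x' y'} → x ≈ y → x' ≈ y' → Adj x x' → Adj y y'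
  adj-cong {x} {y} {x'} {y'} eq eq' adj {S} {S'} CS CS' = begin
    p * (S * (y * (S' * p)))   ≈⟨ *-congˡ (*-congˡ (*-congʳ eq)) ⟨
    p * (S * (x * (S' * p)))   ≈⟨ adj CS CS' ⟩
    p * (S' * (x' * (S * p)))  ≈⟨ *-congˡ (*-congˡ (*-congʳ eq')) ⟩
    p * (S' * (y' * (S * p)))  ∎

  adj-C : ∀ {z} → C z → Adj z z
  adj-C {z} Cz {S} {S'} CS CS' = *-congˡ (begin
    S * (z * (S' * p))  ≈⟨ *-congˡ (swapˡ (C-comm Cz CS') p) ⟩
    S * (S' * (z * p))  ≈⟨ swapˡ (C-comm CS CS') _ ⟩
    S' * (S * (z * p))  ≈⟨ *-congˡ (swapˡ (C-comm CS Cz) p) ⟩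
    S' * (z * (S * p))  ∎)

  -- Both sides are `p` times the product of the scalars e* S e and e* S' e, which commute.
  adj-p : Adj p p
  adj-p {S} {S'} CS CS' = let (a , Ka , eq) = corner S ; (a' , Ka' , eq') = corner S' in begin
    p * (S * (p * (S' * p)))  ≈⟨ *-congˡ (*-congˡ eq') ⟩
    p * (S * (a' * p))        ≈⟨ *-congˡ (swapˡ (K-central Ka' S) p) ⟨
    p * (a' * (S * p))        ≈⟨ swapˡ (K-central Ka' p) _ ⟨
    a' * (p * (S * p))        ≈⟨ *-congˡ eq ⟩
    a' * (a * p)              ≈⟨ swapˡ (K-central Ka' a) p ⟩
    a * (a' * p)              ≈⟨ *-congˡ eq' ⟨
    a * (p * (S' * p))        ≈⟨ swapˡ (K-central Ka p) _ ⟩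
    p * (a * (S' * p))        ≈⟨ *-congˡ (swapˡ (K-central Ka S') p) ⟩
    p * (S' * (a * p))        ≈⟨ *-congˡ (*-congˡ eq) ⟨
    p * (S' * (p * (S * p)))  ∎

  adj-+ : ∀ {x y x' y'} → Adj x x' → Adj y y' → Adj (x + y) (x' + y')
  adj-+ {x} {y} {x'} {y'} ax ay {S} {S'} CS CS' = begin
    p * (S * ((x + y) * (S' * p)))                         ≈⟨ expand S S' x y ⟩
    p * (S * (x * (S' * p))) + p * (S * (y * (S' * p)))    ≈⟨ +-cong (ax CS CS') (ay CS CS') ⟩
    p * (S' * (x' * (S * p))) + p * (S' * (y' * (S * p)))  ≈⟨ expand S' S x' y' ⟨
    p * (S' * ((x' + y') * (S * p)))                       ∎
    where
    expand : ∀ A B u v → p * (A * ((u + v) * (B * p))) ≈ p * (A * (u * (B * p))) + p * (A * (v * (B * p)))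
    expand A B u v = trans (*-congˡ (trans (*-congˡ (distribʳ _ u v)) (distribˡ A _ _))) (distribˡ p _ _)

  adj-neg : ∀ {x x'} → Adj x x' → Adj (- x) (- x')
  adj-neg {x} {x'} ax {S} {S'} CS CS' = begin
    p * (S * (- x * (S' * p)))     ≈⟨ expand S S' x ⟩
    - (p * (S * (x * (S' * p))))   ≈⟨ -‿cong (ax CS CS') ⟩
    - (p * (S' * (x' * (S * p))))  ≈⟨ expand S' S x' ⟨
    p * (S' * (- x' * (S * p)))    ∎
    where
    expand : ∀ A B u → p * (A * (- u * (B * p))) ≈ - (p * (A * (u * (B * p))))
    expand A B u = begin
      p * (A * (- u * (B * p)))    ≈⟨ *-congˡ (*-congˡ (-‿distribˡ-* u _)) ⟨
      p * (A * - (u * (B * p)))    ≈⟨ *-congˡ (-‿distribʳ-* A _) ⟨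
      p * - (A * (u * (B * p)))    ≈⟨ -‿distribʳ-* p _ ⟨
      - (p * (A * (u * (B * p))))  ∎

  -- The vectors y S' e and x' S e are rewritten as T e and T' e with T and T' centralizing `τ`.
  -- Then adjointness of x applies to S and T, and that of y to T' and S'.
  adj-* : ∀ {x y x' y'} → Adj x x' → Adj y y' → Adj (x * y) (y' * x')
  adj-* {x} {y} {x'} {y'} ax ay {S} {S'} CS CS' =
    let (T  , CT  , Tp)  = orbit (y * S')
        (T' , CT' , T'p) = orbit (x' * S) in begin
    p * (S * ((x * y) * (S' * p)))    ≈⟨ *-congˡ (*-congˡ (*-assoc x y _)) ⟩
    p * (S * (x * (y * (S' * p))))    ≈⟨ *-congˡ (*-congˡ (*-congˡ (trans (sym (*-assoc y S' p)) (sym Tp)))) ⟩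
    p * (S * (x * (T * p)))           ≈⟨ ax CS CT ⟩
    p * (T * (x' * (S * p)))          ≈⟨ *-congˡ (*-congˡ (trans (sym (*-assoc x' S p)) (sym T'p))) ⟩
    p * (T * (T' * p))                ≈⟨ *-congˡ (swapˡ (C-comm CT CT') p) ⟩
    p * (T' * (T * p))                ≈⟨ *-congˡ (*-congˡ (trans Tp (*-assoc y S' p))) ⟩
    p * (T' * (y * (S' * p)))         ≈⟨ ay CT' CS' ⟩
    p * (S' * (y' * (T' * p)))        ≈⟨ *-congˡ (*-congˡ (*-congˡ (trans T'p (*-assoc x' S p)))) ⟩
    p * (S' * (y' * (x' * (S * p))))  ≈⟨ *-congˡ (*-congˡ (*-assoc y' x' _)) ⟨
    p * (S' * ((y' * x') * (S * p)))  ∎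

  C-1 : C 1#
  C-1 = trans (*-identityˡ τ) (sym (*-identityʳ τ))

  adj-q : Adj q q
  adj-q = adj-+ (adj-C C-1) (adj-neg adj-p)

  adj-σ : Adj σ σ
  adj-σ = adj-cong refl (*-assoc q τ q) (adj-* adj-q (adj-* (adj-C refl) adj-q))

  poly-adj : ∀ {Q} → Poly σ Q → Adj Q Q
  poly-adj (nil eq) = adj-cong (sym eq) (sym eq) (adj-C (K⇒C K-0))
  poly-adj (step {z} {P} Kz pol eq) = adj-cong (sym eq) (sym eq)
    -- `adj-*` reverses the factors of σ P; since P commutes with `σ`, the reversed product is again
    -- σ P.
    (adj-+ (adj-C (K⇒C Kz)) (adj-cong refl (poly-comm pol refl) (adj-* adj-σ (poly-adj pol))))

  module _ {b u s : Carrier} (Cb : C b) (Cs : C s) (adj-u : Adj u u) where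

    -- Write u b e = T e. Moving u across the form gives e* T S e = e* b u S e = e* s b S e for all
    -- S in the centralizer, so T and s b agree under e*, and `C-counique` identifies them.
    flip : p * (b * u) ≈ p * (b * s) → u * (b * p) ≈ s * (b * p)
    flip eq = let (T , CT , Tp) = orbit (u * b) in begin
      u * (b * p)  ≈⟨ *-assoc u b p ⟨
      (u * b) * p  ≈⟨ Tp ⟨
      T * p        ≈⟨ *-congʳ (C-counique CT Csb (faithfulˡ λ w → pT≈psb T CT Tp w)) ⟩
      (s * b) * p  ≈⟨ *-assoc s b p ⟩
      s * (b * p)  ∎
      where
      Csb : C (s * b)
      Csb = *-comm-closed Cs Cb
      pT≈psb : ∀ T → C T → T * p ≈ (u * b) * p → ∀ w → (p * T) * (w * p) ≈ (p * (s * b)) * (w * p)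
      pT≈psb T CT Tp w = let (S , CS , Sp) = orbit w in begin
        (p * T) * (w * p)        ≈⟨ *-assoc p T _ ⟩
        p * (T * (w * p))        ≈⟨ *-congˡ (*-congˡ Sp) ⟨
        p * (T * (S * p))        ≈⟨ *-congˡ (swapˡ (C-comm CT CS) p) ⟩
        p * (S * (T * p))        ≈⟨ *-congˡ (*-congˡ (trans Tp (*-assoc u b p))) ⟩
        p * (S * (u * (b * p)))  ≈⟨ adj-u CS Cb ⟩
        p * (b * (u * (S * p)))  ≈⟨ *-congˡ (*-assoc b u _) ⟨
        p * ((b * u) * (S * p))  ≈⟨ pullˡ eq _ ⟩
        (p * (b * s)) * (S * p)  ≈⟨ *-cong (*-congˡ (C-comm Cb Cs)) Sp ⟩
        (p * (s * b)) * (w * p)  ∎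

    -- Both u and s are self-adjoint for B, so pairing the vector equation with S e gives the
    -- covector equation at S e; by `orbit` these are all vectors.
    unflip : u * (b * p) ≈ s * (b * p) → p * (b * u) ≈ p * (b * s)
    unflip eq = faithfulˡ λ w → let (S , CS , Sp) = orbit w in begin
      (p * (b * u)) * (w * p)  ≈⟨ assoc₃ u (w * p) ⟩
      p * (b * (u * (w * p)))  ≈⟨ *-congˡ (*-congˡ (*-congˡ Sp)) ⟨
      p * (b * (u * (S * p)))  ≈⟨ adj-u CS Cb ⟨
      p * (S * (u * (b * p)))  ≈⟨ *-congˡ (*-congˡ eq) ⟩
      p * (S * (s * (b * p)))  ≈⟨ adj-C Cs CS Cb ⟩
      p * (b * (s * (S * p)))  ≈⟨ *-congˡ (*-congˡ (*-congˡ Sp)) ⟩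
      p * (b * (s * (w * p)))  ≈⟨ assoc₃ s (w * p) ⟨
      (p * (b * s)) * (w * p)  ∎
      where
      assoc₃ : ∀ x y → (p * (b * x)) * y ≈ p * (b * (x * y))
      assoc₃ x y = trans (*-assoc p _ y) (*-congˡ (*-assoc b x y))

  -- The splitting of V into R e and ker e*

  q+p : q + p ≈ 1#
  q+p = begin
    (1# + - p) + p  ≈⟨ +-assoc 1# (- p) p ⟩
    1# + (- p + p)  ≈⟨ +-congˡ (-‿inverseˡ p) ⟩
    1# + 0#         ≈⟨ +-identityʳ 1# ⟩
    1#              ∎

  split : ∀ x → q * x + p * x ≈ x
  split x = begin
    q * x + p * x  ≈⟨ distribʳ x q p ⟨
    (q + p) * x    ≈⟨ *-congʳ q+p ⟩
    1# * x         ≈⟨ *-identityˡ x ⟩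
    x              ∎

  qx≈x : ∀ {x} → p * x ≈ 0# → q * x ≈ x
  qx≈x {x} px = begin
    q * x          ≈⟨ +-identityʳ _ ⟨
    q * x + 0#     ≈⟨ +-congˡ px ⟨
    q * x + p * x  ≈⟨ split x ⟩
    x              ∎

  px≈0 : ∀ {x} → q * x ≈ x → p * x ≈ 0#
  px≈0 {x} qx = +-cancelˡ x _ _ (begin
    x + p * x      ≈⟨ +-congʳ qx ⟨
    q * x + p * x  ≈⟨ split x ⟩
    x              ≈⟨ +-identityʳ x ⟨
    x + 0#         ∎)

  pq : p * q ≈ 0#
  pq = begin
    p * (1# - p)    ≈⟨ x[y-z]≈xy-xz p 1# p ⟩
    p * 1# - p * p  ≈⟨ +-cong (*-identityʳ p) (-‿cong pp) ⟩
    p - p           ≈⟨ -‿inverseʳ p ⟩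
    0#              ∎

  qp : q * p ≈ 0#
  qp = begin
    (1# - p) * p    ≈⟨ [y-z]x≈yx-zx p 1# p ⟩
    1# * p - p * p  ≈⟨ +-cong (*-identityˡ p) (-‿cong pp) ⟩
    p - p           ≈⟨ -‿inverseʳ p ⟩
    0#              ∎

  qq : q * q ≈ q
  qq = qx≈x pq

  qσ : q * σ ≈ σ
  qσ = pullˡ qq _

  σq : σ * q ≈ σ
  σq = trans (*-assoc q _ q) (*-congˡ (trans (*-assoc τ q q) (*-congˡ qq)))

  -- Polynomials in `σ` preserve ker e*: the constant term commutes with `q`, and every other term
  -- begins with `σ`, whose image lies in ker e*.
  poly-H : ∀ {Q} → Poly σ Q → p * (Q * q) ≈ 0#
  poly-H {Q} (nil eq) = begin
    p * (Q * q)   ≈⟨ *-congˡ (*-congʳ eq) ⟩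
    p * (0# * q)  ≈⟨ *-congˡ (zeroˡ q) ⟩
    p * 0#        ≈⟨ zeroʳ p ⟩
    0#            ∎
  poly-H {Q} (step {z} {P} Kz pol eq) = begin
    p * (Q * q)                        ≈⟨ *-congˡ (*-congʳ eq) ⟩
    p * ((z + σ * P) * q)              ≈⟨ *-congˡ (distribʳ q z _) ⟩
    p * (z * q + (σ * P) * q)          ≈⟨ distribˡ p _ _ ⟩
    p * (z * q) + p * ((σ * P) * q)    ≈⟨ +-cong (*-congˡ (K-central Kz q)) (*-congˡ (*-assoc σ P q)) ⟩
    p * (q * z) + p * (σ * (P * q))    ≈⟨ +-cong (pullˡ pq z) (pullˡ (px≈0 qσ) _) ⟩
    0# * z + 0# * (P * q)              ≈⟨ +-cong (zeroˡ _) (zeroˡ _) ⟩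
    0# + 0#                            ≈⟨ +-identityˡ 0# ⟩
    0#                                 ∎

  poly-qQq : ∀ {Q} → Poly σ Q → q * (Q * q) ≈ Q * q
  poly-qQq pol = qx≈x (poly-H pol)

  -- Vectors as combinations of e and polynomials in `σ` applied to q τ e

  f : Carrier
  f = q * (τ * p)

  qf : q * f ≈ f
  qf = pullˡ qq _

  -- Induction along the Horner form. One more application of `τ` sends e to f + (e* τ e) e, and
  -- sends Q f, which lies in ker e*, to σ Q f plus a multiple of e.
  decompose-poly : ∀ {P} → Poly τ P →
    Σ Carrier λ c → Σ Carrier λ Q → K c × Poly σ Q × P * p ≈ c * p + Q * f
  decompose-poly {P} (nil eq) = 0# , 0# , K-0 , nil refl , (begin
    P * p            ≈⟨ *-congʳ eq ⟩
    0# * p           ≈⟨ +-identityʳ _ ⟨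
    0# * p + 0#      ≈⟨ +-congˡ (zeroˡ f) ⟨
    0# * p + 0# * f  ∎)
  decompose-poly {P'} (step {z} {P} Kz pol eq) =
    let (c , Q , Kc , polQ , Pp) = decompose-poly pol
        (a , Ka , pτp) = corner τ
        -- Q f is Q (q τ) applied to e, so its coefficient e* τ Q f is available from `corner`.
        (d , Kd , pτQf) = corner (τ * (Q * (q * τ)))
        pτQf' : p * (τ * (Q * f)) ≈ d * p
        pτQf' = begin
          p * (τ * (Q * (q * (τ * p))))    ≈⟨ *-congˡ (*-congˡ (*-congˡ (*-assoc q τ p))) ⟨
          p * (τ * (Q * ((q * τ) * p)))    ≈⟨ *-congˡ (*-congˡ (*-assoc Q _ p)) ⟨
          p * (τ * ((Q * (q * τ)) * p))    ≈⟨ *-congˡ (*-assoc τ _ p) ⟨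
          p * ((τ * (Q * (q * τ))) * p)    ≈⟨ pτQf ⟩
          d * p                            ∎
        qQf : q * (Q * f) ≈ Q * f
        qQf = begin
          q * (Q * f)        ≈⟨ *-congˡ (*-congˡ qf) ⟨
          q * (Q * (q * f))  ≈⟨ *-congˡ (*-assoc Q q f) ⟨
          q * ((Q * q) * f)  ≈⟨ pullˡ (poly-qQq polQ) f ⟩
          (Q * q) * f        ≈⟨ *-assoc Q q f ⟩
          Q * (q * f)        ≈⟨ *-congˡ qf ⟩
          Q * f              ∎
        τcp : τ * (c * p) ≈ c * f + (c * a) * p
        τcp = begin
          τ * (c * p)                      ≈⟨ swapˡ (K-central Kc τ) p ⟨
          c * (τ * p)                      ≈⟨ *-congˡ (split (τ * p)) ⟨
          c * (f + p * (τ * p))            ≈⟨ distribˡ c f _ ⟩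
          c * f + c * (p * (τ * p))        ≈⟨ +-congˡ (*-congˡ pτp) ⟩
          c * f + c * (a * p)              ≈⟨ +-congˡ (*-assoc c a p) ⟨
          c * f + (c * a) * p              ∎
        τQf : τ * (Q * f) ≈ (σ * Q) * f + d * p
        τQf = begin
          τ * (Q * f)                                  ≈⟨ split (τ * (Q * f)) ⟨
          -- Since Q f lies in ker e*, a factor `q` can be inserted in front of it, completing q τ
          -- to `σ`.
          q * (τ * (Q * f)) + p * (τ * (Q * f))        ≈⟨ +-cong (*-congˡ (*-congˡ (sym qQf))) pτQf' ⟩
          q * (τ * (q * (Q * f))) + d * p              ≈⟨ +-congʳ (trans (*-congˡ (sym (*-assoc τ q _))) (sym (*-assoc q _ _))) ⟩
          σ * (Q * f) + d * p                          ≈⟨ +-congʳ (*-assoc σ Q f) ⟨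
          (σ * Q) * f + d * p                          ∎
    -- The scalar collects the e-components of z e, τ (c e) and τ (Q f). The old c becomes the
    -- constant term of the new polynomial, because q τ (c e) = c f.
    in z + (c * a + d) , c + σ * Q , K-+ Kz (K-+ (K-* Kc Ka) Kd) , step Kc polQ refl , (begin
      P' * p                                                       ≈⟨ *-congʳ eq ⟩
      (z + τ * P) * p                                              ≈⟨ distribʳ p z _ ⟩
      z * p + (τ * P) * p                                          ≈⟨ +-congˡ (*-assoc τ P p) ⟩
      z * p + τ * (P * p)                                          ≈⟨ +-congˡ (*-congˡ Pp) ⟩
      z * p + τ * (c * p + Q * f)                                  ≈⟨ +-congˡ (distribˡ τ _ _) ⟩
      z * p + (τ * (c * p) + τ * (Q * f))                          ≈⟨ +-congˡ (+-cong τcp τQf) ⟩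
      z * p + ((c * f + (c * a) * p) + ((σ * Q) * f + d * p))      ≈⟨ +-congˡ (interchange _ _ _ _) ⟩
      z * p + ((c * f + (σ * Q) * f) + ((c * a) * p + d * p))      ≈⟨ +-congˡ (+-cong (distribʳ f c _) (distribʳ p _ d)) ⟨
      z * p + ((c + σ * Q) * f + (c * a + d) * p)                  ≈⟨ +-congˡ (+-comm _ _) ⟩
      z * p + ((c * a + d) * p + (c + σ * Q) * f)                  ≈⟨ +-assoc _ _ _ ⟨
      (z * p + (c * a + d) * p) + (c + σ * Q) * f                  ≈⟨ +-congʳ (distribʳ p z _) ⟨
      (z + (c * a + d)) * p + (c + σ * Q) * f                      ∎)

  decompose : ∀ w → Σ Carrier λ c → Σ Carrier λ Q → K c × Poly σ Q × w * p ≈ c * p + Q * f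
  decompose w = let (P , pol , Pp) = cyclic w
                    (c , Q , Kc , polQ , eq) = decompose-poly pol in
                c , Q , Kc , polQ , trans (sym Pp) eq

  -- The Lie algebra of the centralizer of σ in H.
  InLie : Carrier → Set ℓ
  InLie u = u * p ≈ 0# × p * u ≈ 0# × u * σ ≈ σ * u

  poly⇒InLie : ∀ {Q} → Poly σ Q → InLie (Q * q)
  poly⇒InLie {Q} pol = trans (*-assoc Q q p) (trans (*-congˡ qp) (zeroʳ Q)) , poly-H pol , (begin
    (Q * q) * σ  ≈⟨ *-assoc Q q σ ⟩
    Q * (q * σ)  ≈⟨ *-congˡ qσ ⟩
    Q * σ        ≈⟨ Qσ ⟩
    σ * Q        ≈⟨ Qσ ⟨
    Q * σ        ≈⟨ *-congˡ σq ⟨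
    Q * (σ * q)  ≈⟨ *-assoc Q σ q ⟨
    (Q * σ) * q  ≈⟨ *-congʳ Qσ ⟩
    (σ * Q) * q  ≈⟨ *-assoc σ Q q ⟩
    σ * (Q * q)  ∎)
    where
    Qσ : Q * σ ≈ σ * Q
    Qσ = poly-comm pol refl

  -- As u kills e and commutes with `σ`, the decomposition of V shows that it is determined by u f.
  -- Write u f = c e + Q f; applying e* shows c e = 0, so u and Q q agree on f and on e.
  InLie⇒poly : ∀ {u} → InLie u → Σ Carrier λ Q → Poly σ Q × u ≈ Q * q
  InLie⇒poly {u} (up , pu , uσ) = let (c , Q , Kc , polQ , eq) = decompose (u * (q * τ)) in
    Q , polQ , faithfulˡ (agree c Q Kc polQ (trans (trans (*-congˡ (sym (*-assoc q τ p))) (sym (*-assoc u _ p))) eq))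
    where
    module _ (c Q : Carrier) (Kc : K c) (polQ : Poly σ Q) (eq : u * f ≈ c * p + Q * f) where
      pxf : ∀ {Q'} → Poly σ Q' → p * (Q' * f) ≈ 0#
      pxf {Q'} pol = begin
        p * (Q' * f)        ≈⟨ *-congˡ (*-congˡ qf) ⟨
        p * (Q' * (q * f))  ≈⟨ *-congˡ (*-assoc Q' q f) ⟨
        p * ((Q' * q) * f)  ≈⟨ pullˡ (poly-H pol) f ⟩
        0# * f              ≈⟨ zeroˡ f ⟩
        0#                  ∎
      cp : c * p ≈ 0#
      cp = begin
        c * p                        ≈⟨ *-congˡ pp ⟨
        c * (p * p)                  ≈⟨ swapˡ (K-central Kc p) p ⟩
        p * (c * p)                  ≈⟨ +-identityʳ _ ⟨
        p * (c * p) + 0#             ≈⟨ +-congˡ (pxf polQ) ⟨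
        p * (c * p) + p * (Q * f)    ≈⟨ distribˡ p _ _ ⟨
        p * (c * p + Q * f)          ≈⟨ *-congˡ eq ⟨
        p * (u * f)                  ≈⟨ pullˡ pu f ⟩
        0# * f                       ≈⟨ zeroˡ f ⟩
        0#                           ∎
      uf : u * f ≈ Q * f
      uf = trans eq (trans (+-congʳ cp) (+-identityˡ _))
      kill : ∀ {x c' y} → K c' → x * p ≈ 0# → x * (c' * p + y) ≈ x * y
      kill {x} {c'} {y} Kc' xp = begin
        x * (c' * p + y)      ≈⟨ distribˡ x _ y ⟩
        x * (c' * p) + x * y  ≈⟨ +-congʳ (swapˡ (K-central Kc' x) p) ⟨
        c' * (x * p) + x * y  ≈⟨ +-congʳ (trans (*-congˡ xp) (zeroʳ c')) ⟩
        0# + x * y            ≈⟨ +-identityˡ _ ⟩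
        x * y                 ∎
      agree : ∀ w → u * (w * p) ≈ (Q * q) * (w * p)
      agree w = let (c' , Q' , Kc' , polQ' , eq') = decompose w in begin
        u * (w * p)                  ≈⟨ *-congˡ eq' ⟩
        u * (c' * p + Q' * f)        ≈⟨ kill Kc' up ⟩
        u * (Q' * f)                 ≈⟨ swapˡ (poly-comm polQ' uσ) f ⟨
        Q' * (u * f)                 ≈⟨ *-congˡ uf ⟩
        Q' * (Q * f)                 ≈⟨ swapˡ (poly-comm polQ' (poly-comm polQ refl)) f ⟩
        Q * (Q' * f)                 ≈⟨ *-congˡ (qx≈x (pxf polQ')) ⟨
        Q * (q * (Q' * f))           ≈⟨ *-assoc Q q _ ⟨
        (Q * q) * (Q' * f)           ≈⟨ kill Kc' (proj₁ (poly⇒InLie polQ)) ⟨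
        (Q * q) * (c' * p + Q' * f)  ≈⟨ *-congˡ eq' ⟨
        (Q * q) * (w * p)            ∎

  -- By `InLie⇒poly`, u = q Q q with Q a polynomial in `σ`: a product of self-adjoint factors that
  -- is unchanged when reversed.
  InLie-adj : ∀ {u} → InLie u → Adj u u
  InLie-adj lie = let (Q , pol , eq) = InLie⇒poly lie in
    adj-cong (trans (poly-qQq pol) (sym eq))
      (trans (*-assoc q Q q) (trans (poly-qQq pol) (sym eq)))
      (adj-* adj-q (adj-* (poly-adj pol) adj-q))

  xw≈0 : ∀ {x} → x ≈ 0# → ∀ w → x * w ≈ 0#
  xw≈0 eq w = trans (*-congʳ eq) (zeroˡ w)

  wx≈0 : ∀ {x} → x ≈ 0# → ∀ w → w * x ≈ 0#
  wx≈0 eq w = trans (*-congˡ eq) (zeroʳ w)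

  corner₂ : ∀ x y → Σ Carrier λ z → K z × p * (x * (y * p)) ≈ z * p
  corner₂ x y = let (z , Kz , eq) = corner (x * y) in z , Kz , trans (*-congˡ (sym (*-assoc x y p))) eq

  -- The splitting condition and the square of b

  module Tangency {b b⁻ : Carrier} (Cb : C b) (inv : IsInverse b b⁻) where

    Cb⁻ : C b⁻
    Cb⁻ = inverse-comm inv Cb

    -- b u b⁻¹ lies in Lie(H) + Lie(G_τ), with second component b s b⁻¹ = s.
    Splits : Carrier → Set (m ⊔ ℓ)
    Splits u = Σ Carrier λ s → C s × u * (b⁻ * p) ≈ s * (b⁻ * p) × p * (b * u) ≈ p * (b * s)

    -- Since s commutes with b², the first equation gives b² u b⁻¹ e = s b e; `flip` turns the
    -- second into u b e = s b e.
    splits⇒fixed : ∀ {u} → InLie u → Splits u → (b * b) * (u * (b⁻ * p)) ≈ u * (b * p)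
    splits⇒fixed {u} lie (s , Cs , eq₁ , eq₂) = begin
      (b * b) * (u * (b⁻ * p))  ≈⟨ *-congˡ eq₁ ⟩
      (b * b) * (s * (b⁻ * p))  ≈⟨ swapˡ (C-comm (*-comm-closed Cb Cb) Cs) _ ⟩
      s * ((b * b) * (b⁻ * p))  ≈⟨ *-congˡ (*-assoc b b _) ⟩
      s * (b * (b * (b⁻ * p)))  ≈⟨ *-congˡ (*-congˡ (cancelˡ (proj₁ inv) p)) ⟩
      s * (b * p)               ≈⟨ flip Cb Cs (InLie-adj lie) eq₂ ⟨
      u * (b * p)               ∎

    -- By `C-unique` it suffices that b² e lies in R e. Expand b² e by `p-decomposition`; `q-part`
    -- and `τ-part` bring a factor `p` to the front of each term, which `corner` then makes a scalar
    -- multiple of `p`.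
    splits⇒square-scalar : (∀ {u} → InLie u → Splits u) → Σ Carrier λ z → K z × b * b ≈ z
    splits⇒square-scalar splits =
      let (c , Q , Kc , polQ , bp) = decompose b
          (β , Kβ , pbp) = corner b
          u = Q * q
          (γ , Kγ , pτbbw) = corner₂ (τ * (b * b)) (u * b⁻)
          -- Here β = e* b e and γ = e* τ b² u b⁻¹ e.
          z = c * β + γ
          Kz = K-+ (K-* Kc Kβ) Kγ
      in z , Kz , C-unique (*-comm-closed Cb Cb) (K⇒C Kz) (begin
      (b * b) * p                                                        ≈⟨ *-congˡ (p-decomposition c Q Kc polQ bp) ⟩
      (b * b) * (c * (p * (b⁻ * p)) + p * (τ * (u * (b⁻ * p))))          ≈⟨ distribˡ (b * b) _ _ ⟩
      (b * b) * (c * (p * (b⁻ * p))) + (b * b) * (p * (τ * (u * (b⁻ * p))))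
        ≈⟨ +-cong (sym (swapˡ (K-central Kc _) _)) (sym (τ-part polQ)) ⟩
      c * ((b * b) * (p * (b⁻ * p))) + p * (τ * ((b * b) * (u * (b⁻ * p)))) ≈⟨ +-congʳ (*-congˡ q-part) ⟩
      c * (p * (b * p)) + p * (τ * ((b * b) * (u * (b⁻ * p))))
        ≈⟨ +-cong (*-congˡ pbp) (*-congˡ (*-congˡ (*-congˡ (sym (*-assoc u b⁻ p))))) ⟩
      c * (β * p) + p * (τ * ((b * b) * ((u * b⁻) * p)))
        ≈⟨ +-cong (sym (*-assoc c β p)) (trans (*-congˡ (sym (*-assoc τ _ _))) pτbbw) ⟩
      (c * β) * p + γ * p                                                ≈⟨ distribʳ p _ _ ⟨
      (c * β + γ) * p                                                    ∎)
      where
      q-lie : InLie q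
      q-lie = qp , pq , trans qσ (sym σq)

      -- `splits⇒fixed` at u = q says b² q b⁻¹ e = q b e. Subtract it from b² b⁻¹ e = b e, with both
      -- sides split by q + p = 1.
      q-part : (b * b) * (p * (b⁻ * p)) ≈ p * (b * p)
      q-part = +-cancelˡ (q * (b * p)) _ _ (begin
        q * (b * p) + (b * b) * (p * (b⁻ * p))
          ≈⟨ +-congʳ (splits⇒fixed q-lie (splits q-lie)) ⟨
        (b * b) * (q * (b⁻ * p)) + (b * b) * (p * (b⁻ * p))  ≈⟨ distribˡ (b * b) _ _ ⟨
        (b * b) * (q * (b⁻ * p) + p * (b⁻ * p))              ≈⟨ *-congˡ (split _) ⟩
        (b * b) * (b⁻ * p)                                   ≈⟨ *-assoc b b _ ⟩
        b * (b * (b⁻ * p))                                   ≈⟨ *-congˡ (cancelˡ (proj₁ inv) p) ⟩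
        b * p                                                ≈⟨ split (b * p) ⟨
        q * (b * p) + p * (b * p)                            ∎)

      -- Put t = b² and w = u b⁻¹ e; both w and t w lie in ker e*, so q τ acts on them as `σ`. By
      -- `splits⇒fixed` for u and σ u, t σ w = σ t w. Subtracting this from t τ w = τ t w leaves the
      -- components along `p`.
      τ-part : ∀ {Q} → Poly σ Q →
        p * (τ * ((b * b) * ((Q * q) * (b⁻ * p)))) ≈ (b * b) * (p * (τ * ((Q * q) * (b⁻ * p))))
      τ-part {Q} pol = +-cancelˡ (t * (q * (τ * w))) _ _ (begin
        t * (q * (τ * w)) + p * (τ * (t * w))        ≈⟨ +-congʳ (*-congˡ (*-congˡ (*-congˡ qw))) ⟨
        t * (q * (τ * (q * w))) + p * (τ * (t * w))  ≈⟨ +-congʳ (*-congˡ (σ-expand w)) ⟨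
        t * (σ * w) + p * (τ * (t * w))              ≈⟨ +-congʳ tσw ⟩
        σ * (t * w) + p * (τ * (t * w))              ≈⟨ +-congʳ (σ-expand (t * w)) ⟩
        q * (τ * (q * (t * w))) + p * (τ * (t * w))  ≈⟨ +-congʳ (*-congˡ (*-congˡ qtw)) ⟩
        q * (τ * (t * w)) + p * (τ * (t * w))        ≈⟨ split _ ⟩
        τ * (t * w)                                  ≈⟨ swapˡ (*-comm-closed Cb Cb) w ⟨
        t * (τ * w)                                  ≈⟨ *-congˡ (split _) ⟨
        t * (q * (τ * w) + p * (τ * w))              ≈⟨ distribˡ t _ _ ⟩
        t * (q * (τ * w)) + t * (p * (τ * w))        ∎)
        where
        t = b * b
        u = Q * q
        w = u * (b⁻ * p)
        lie : InLie u
        lie = poly⇒InLie pol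
        tw : t * w ≈ u * (b * p)
        tw = splits⇒fixed lie (splits lie)
        σ-expand : ∀ x → σ * x ≈ q * (τ * (q * x))
        σ-expand x = trans (*-assoc q _ x) (*-congˡ (*-assoc τ q x))
        qw : q * w ≈ w
        qw = pullˡ (qx≈x (proj₁ (proj₂ lie))) _
        qtw : q * (t * w) ≈ t * w
        qtw = trans (*-congˡ tw) (trans (pullˡ (qx≈x (proj₁ (proj₂ lie))) _) (sym tw))
        σu-lie : InLie (σ * u)
        σu-lie = trans (*-assoc σ u p) (wx≈0 (proj₁ lie) σ)
               , trans (pullˡ (px≈0 qσ) u) (zeroˡ u)
               , *-comm-closed refl (proj₂ (proj₂ lie))
        tσw : t * (σ * w) ≈ σ * (t * w)
        tσw = begin
          t * (σ * w)               ≈⟨ *-congˡ (*-assoc σ u _) ⟨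
          t * ((σ * u) * (b⁻ * p))  ≈⟨ splits⇒fixed σu-lie (splits σu-lie) ⟩
          (σ * u) * (b * p)         ≈⟨ *-assoc σ u _ ⟩
          σ * (u * (b * p))         ≈⟨ *-congˡ tw ⟨
          σ * (t * w)               ∎

      -- p = e* b b⁻¹ e e*, with b e moved to the left of the form B and written as c e + Q qτ e.
      p-decomposition : ∀ c Q → K c → Poly σ Q → b * p ≈ c * p + Q * f →
        p ≈ c * (p * (b⁻ * p)) + p * (τ * ((Q * q) * (b⁻ * p)))
      p-decomposition c Q Kc pol bp = begin
        p                                                    ≈⟨ pp ⟨
        p * p                                                ≈⟨ *-congˡ (cancelˡ (proj₂ inv) p) ⟨
        p * (b⁻ * (b * p))                                   ≈⟨ *-congˡ (*-congˡ bp) ⟩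
        p * (b⁻ * (c * p + Q * f))                           ≈⟨ trans (*-congˡ (distribˡ b⁻ _ _)) (distribˡ p _ _) ⟩
        p * (b⁻ * (c * p)) + p * (b⁻ * (Q * f))
          ≈⟨ +-cong (trans (*-congˡ (sym (swapˡ (K-central Kc b⁻) p))) (sym (swapˡ (K-central Kc p) _)))
                    (*-congˡ (*-congˡ (sym (*-assoc Q q _)))) ⟩
        c * (p * (b⁻ * p)) + p * (b⁻ * ((Q * q) * (τ * p)))  ≈⟨ +-congˡ (InLie-adj (poly⇒InLie pol) Cb⁻ refl) ⟩
        c * (p * (b⁻ * p)) + p * (τ * ((Q * q) * (b⁻ * p)))  ∎

    -- Since b² = z, multiplying the first equation by z replaces b⁻¹ by b, and `unflip` derives the
    -- second from the same identity u b e = s b e.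
    square-scalar⇒splits : ∀ {z} → K z → b * b ≈ z → ∀ {u} → InLie u → Splits u
    square-scalar⇒splits {z} Kz bb {u} lie =
      -- Chosen so that s e = b⁻¹ u b e, whence s b e = b s e = u b e.
      let (s , Cs , sp) = orbit (b⁻ * (u * b))
          ubp = begin
            u * (b * p)               ≈⟨ *-assoc u b p ⟨
            (u * b) * p               ≈⟨ cancelˡ (proj₁ inv) _ ⟨
            b * (b⁻ * ((u * b) * p))  ≈⟨ *-congˡ (*-assoc b⁻ _ p) ⟨
            b * ((b⁻ * (u * b)) * p)  ≈⟨ *-congˡ sp ⟨
            b * (s * p)               ≈⟨ swapˡ (C-comm Cb Cs) p ⟩
            s * (b * p)               ∎
      in s , Cs , cancel-z (begin
        z * (u * (b⁻ * p))  ≈⟨ move u ⟩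
        u * (b * p)         ≈⟨ ubp ⟩
        s * (b * p)         ≈⟨ move s ⟨
        z * (s * (b⁻ * p))  ∎) , unflip Cb Cs (InLie-adj lie) ubp
      where
      move : ∀ x → z * (x * (b⁻ * p)) ≈ x * (b * p)
      move x = begin
        z * (x * (b⁻ * p))        ≈⟨ swapˡ (K-central Kz x) _ ⟩
        x * (z * (b⁻ * p))        ≈⟨ *-congˡ (*-congʳ bb) ⟨
        x * ((b * b) * (b⁻ * p))  ≈⟨ *-congˡ (*-assoc b b _) ⟩
        x * (b * (b * (b⁻ * p)))  ≈⟨ *-congˡ (*-congˡ (cancelˡ (proj₁ inv) p)) ⟩
        x * (b * p)               ∎
      cancel-z : ∀ {x y} → z * x ≈ z * y → x ≈ y
      cancel-z {x} {y} eq = trans (sym (undo x)) (trans (*-congˡ (*-congˡ eq)) (undo y))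
        where
        undo : ∀ x → b⁻ * (b⁻ * (z * x)) ≈ x
        undo x = begin
          b⁻ * (b⁻ * (z * x))        ≈⟨ *-congˡ (*-congˡ (*-congʳ bb)) ⟨
          b⁻ * (b⁻ * ((b * b) * x))  ≈⟨ *-congˡ (*-congˡ (*-assoc b b x)) ⟩
          b⁻ * (b⁻ * (b * (b * x)))  ≈⟨ *-congˡ (cancelˡ (proj₂ inv) _) ⟩
          b⁻ * (b * x)               ≈⟨ cancelˡ (proj₂ inv) x ⟩
          x                          ∎

    -- Tangent vectors and first-order factorisations

    module Factorisation {a y y⁻ h h⁻ : Carrier} (inv-y : IsInverse y y⁻) (yp : y * p ≈ p) (py : p * y ≈ p)
      (yσ : y * σ ≈ σ * y) (inv-h : IsInverse h h⁻) (hp : h * p ≈ p) (ph : p * h ≈ p)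
      (ay : a * y ≈ h * b) where

      -- The ε-part of the factorisation of a (y + ε y₁) as (h + ε h₁) (b + ε b₁).
      Factors : Carrier → Set (m ⊔ ℓ)
      Factors y₁ = Σ Carrier λ h₁ → Σ Carrier λ b₁ →
        h₁ * p ≈ 0# × p * h₁ ≈ 0# × C b₁ × a * y₁ ≈ h * b₁ + h₁ * b

      -- Apply the hypothesis to y₁ = y u and cancel h: b u = b₁ + h⁻¹ h₁ b. The last term kills b⁻¹
      -- e and is killed by e* on the left, so s = b⁻¹ b₁ satisfies both equations.
      factors⇒splits : (∀ {y₁} → InLie y₁ → Factors y₁) → ∀ {u} → InLie u → Splits u
      factors⇒splits factors {u} (up , pu , uσ) =
        let (h₁ , b₁ , h₁p , ph₁ , Cb₁ , eq) = factors
              ( trans (*-assoc y u p) (wx≈0 up y)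
              , trans (pullˡ py u) pu
              , *-comm-closed yσ uσ)
            bu : b * u ≈ b₁ + h⁻ * (h₁ * b)
            bu = begin
              b * u                                ≈⟨ cancelˡ (proj₂ inv-h) _ ⟨
              h⁻ * (h * (b * u))                   ≈⟨ *-congˡ (pullˡ (sym ay) u) ⟩
              h⁻ * ((a * y) * u)                   ≈⟨ *-congˡ (trans (*-assoc a y u) eq) ⟩
              h⁻ * (h * b₁ + h₁ * b)               ≈⟨ distribˡ h⁻ _ _ ⟩
              h⁻ * (h * b₁) + h⁻ * (h₁ * b)        ≈⟨ +-congʳ (cancelˡ (proj₂ inv-h) b₁) ⟩
              b₁ + h⁻ * (h₁ * b)                   ∎
        in b⁻ * b₁ , *-comm-closed Cb⁻ Cb₁ , (begin
          u * (b⁻ * p)                                    ≈⟨ cancelˡ (proj₂ inv) _ ⟨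
          b⁻ * (b * (u * (b⁻ * p)))                       ≈⟨ *-congˡ (*-assoc b u _) ⟨
          b⁻ * ((b * u) * (b⁻ * p))                       ≈⟨ *-congˡ (*-congʳ bu) ⟩
          b⁻ * ((b₁ + h⁻ * (h₁ * b)) * (b⁻ * p))          ≈⟨ *-congˡ (distribʳ _ b₁ _) ⟩
          b⁻ * (b₁ * (b⁻ * p) + (h⁻ * (h₁ * b)) * (b⁻ * p))
            ≈⟨ *-congˡ (+-congˡ (begin
              (h⁻ * (h₁ * b)) * (b⁻ * p)  ≈⟨ *-assoc h⁻ _ _ ⟩
              h⁻ * ((h₁ * b) * (b⁻ * p))  ≈⟨ *-congˡ (*-assoc h₁ b _) ⟩
              h⁻ * (h₁ * (b * (b⁻ * p)))  ≈⟨ *-congˡ (*-congˡ (cancelˡ (proj₁ inv) p)) ⟩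
              h⁻ * (h₁ * p)               ≈⟨ wx≈0 h₁p h⁻ ⟩
              0#                          ∎)) ⟩
          b⁻ * (b₁ * (b⁻ * p) + 0#)                       ≈⟨ *-congˡ (+-identityʳ _) ⟩
          b⁻ * (b₁ * (b⁻ * p))                            ≈⟨ *-assoc b⁻ b₁ _ ⟨
          (b⁻ * b₁) * (b⁻ * p)                            ∎) , (begin
          p * (b * u)                                     ≈⟨ *-congˡ bu ⟩
          p * (b₁ + h⁻ * (h₁ * b))                        ≈⟨ distribˡ p b₁ _ ⟩
          p * b₁ + p * (h⁻ * (h₁ * b))                    ≈⟨ +-congˡ (pullˡ (inverse-fixʳ inv-h ph) _) ⟩
          p * b₁ + p * (h₁ * b)                           ≈⟨ +-congˡ (trans (pullˡ ph₁ b) (zeroˡ b)) ⟩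
          p * b₁ + 0#                                     ≈⟨ +-identityʳ _ ⟩
          p * b₁                                          ≈⟨ *-congˡ (cancelˡ (proj₁ inv) b₁) ⟨
          p * (b * (b⁻ * b₁))                             ∎)

      -- With u = y⁻¹ y₁ and b₁ = b s, the equation h b u = h b₁ + h₁ b forces h₁ = h (b u - b s)
      -- b⁻¹. The two equations for s say exactly that h₁ e = 0 and e* h₁ = 0.
      splits⇒factors : (∀ {u} → InLie u → Splits u) → ∀ {y₁} → InLie y₁ → Factors y₁
      splits⇒factors splits {y₁} (y₁p , py₁ , y₁σ) =
        let u = y⁻ * y₁
            (s , Cs , eq₁ , eq₂) = splits {u}
              ( trans (*-assoc y⁻ y₁ p) (wx≈0 y₁p y⁻)
              , trans (pullˡ (inverse-fixʳ inv-y py) y₁) py₁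
              , *-comm-closed (inverse-comm inv-y yσ) y₁σ)
            d = b * u - b * s
            h₁ = h * (d * b⁻)
        in h₁ , b * s
          , (begin
            (h * (d * b⁻)) * p                             ≈⟨ trans (*-assoc h _ p) (*-congˡ (*-assoc d b⁻ p)) ⟩
            h * (d * (b⁻ * p))                             ≈⟨ *-congˡ ([y-z]x≈yx-zx (b⁻ * p) (b * u) (b * s)) ⟩
            h * ((b * u) * (b⁻ * p) - (b * s) * (b⁻ * p))
              ≈⟨ *-congˡ (+-congʳ (trans (*-assoc b u _) (trans (*-congˡ eq₁) (sym (*-assoc b s _))))) ⟩
            h * ((b * s) * (b⁻ * p) - (b * s) * (b⁻ * p))  ≈⟨ wx≈0 (-‿inverseʳ _) h ⟩
            0#                                             ∎)
          , (begin
            p * (h * (d * b⁻))              ≈⟨ pullˡ ph _ ⟩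
            p * (d * b⁻)                    ≈⟨ pullˡ (x[y-z]≈xy-xz p (b * u) (b * s)) b⁻ ⟩
            (p * (b * u) - p * (b * s)) * b⁻  ≈⟨ xw≈0 (trans (+-congʳ eq₂) (-‿inverseʳ _)) b⁻ ⟩
            0#                              ∎)
          , *-comm-closed Cb Cs
          , (begin
            a * y₁                           ≈⟨ *-congˡ (cancelˡ (proj₁ inv-y) y₁) ⟨
            a * (y * u)                      ≈⟨ pullˡ ay u ⟩
            (h * b) * u                      ≈⟨ *-assoc h b u ⟩
            h * (b * u)                      ≈⟨ *-congˡ (+-identityʳ _) ⟨
            h * (b * u + 0#)                 ≈⟨ *-congˡ (+-congˡ (-‿inverseˡ (b * s))) ⟨
            h * (b * u + (- (b * s) + b * s))  ≈⟨ *-congˡ (+-assoc _ _ _) ⟨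
            h * (d + b * s)                  ≈⟨ *-congˡ (+-comm d _) ⟩
            h * (b * s + d)                  ≈⟨ distribˡ h _ d ⟩
            h * (b * s) + h * d              ≈⟨ +-congˡ (*-congˡ (trans (*-assoc d b⁻ b) (trans (*-congˡ (proj₂ inv)) (*-identityʳ d)))) ⟨
            h * (b * s) + h * ((d * b⁻) * b) ≈⟨ +-congˡ (*-assoc h _ b) ⟨
            h * (b * s) + h₁ * b             ∎)

  -- The element h'⁻¹ h = b' b⁻¹ fixes e and commutes with `τ`, so it is 1 by `C-unique`.
  factorisation-unique : ∀ {h h' h'⁻ b b⁻ b'} → h * p ≈ p → IsInverse h' h'⁻ → h' * p ≈ p →
    IsInverse b b⁻ → C b → C b' → h * b ≈ h' * b' → h' ≈ h × b' ≈ b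
  factorisation-unique {h} {h'} {h'⁻} {b} {b⁻} {b'} hp inv-h' h'p inv Cb Cb' eq = h'≈h , b'≈b
    where
    g≈b'b⁻ : h'⁻ * h ≈ b' * b⁻
    g≈b'b⁻ = begin
      h'⁻ * h                ≈⟨ *-congˡ (trans (*-congˡ (proj₁ inv)) (*-identityʳ h)) ⟨
      h'⁻ * (h * (b * b⁻))   ≈⟨ *-congˡ (pullˡ eq b⁻) ⟩
      h'⁻ * ((h' * b') * b⁻) ≈⟨ *-congˡ (*-assoc h' b' b⁻) ⟩
      h'⁻ * (h' * (b' * b⁻)) ≈⟨ cancelˡ (proj₂ inv-h') _ ⟩
      b' * b⁻                ∎
    b'b⁻≈1 : b' * b⁻ ≈ 1#
    b'b⁻≈1 = C-unique (*-comm-closed Cb' (inverse-comm inv Cb)) C-1 (begin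
      (b' * b⁻) * p  ≈⟨ *-congʳ g≈b'b⁻ ⟨
      (h'⁻ * h) * p  ≈⟨ *-assoc h'⁻ h p ⟩
      h'⁻ * (h * p)  ≈⟨ *-congˡ hp ⟩
      h'⁻ * p        ≈⟨ inverse-fixˡ inv-h' h'p ⟩
      p              ≈⟨ *-identityˡ p ⟨
      1# * p         ∎)
    b'≈b : b' ≈ b
    b'≈b = begin
      b'              ≈⟨ *-identityʳ b' ⟨
      b' * 1#         ≈⟨ *-congˡ (proj₂ inv) ⟨
      b' * (b⁻ * b)   ≈⟨ pullˡ b'b⁻≈1 b ⟩
      1# * b          ≈⟨ *-identityˡ b ⟩
      b               ∎
    h'≈h : h' ≈ h
    h'≈h = begin
      h'              ≈⟨ *-identityʳ h' ⟨
      h' * 1#         ≈⟨ *-congˡ (trans g≈b'b⁻ b'b⁻≈1) ⟨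
      h' * (h'⁻ * h)  ≈⟨ cancelˡ (proj₁ inv-h') h ⟩
      h               ∎

-- Matrices over R and the coordinates of e, e*

module Matrices {c ℓ} (R : CommutativeRing c ℓ) (n : ℕ) (e e* : Fin n → ℤ) where
  open CommutativeRing R hiding (zero)
  open RingProperties ring using (-‿distribˡ-*; -‿distribʳ-*; -0#≈0#; -‿involutive; -‿+-comm)
  open Lin rawRing n e e*
  open SetoidReasoning setoid
  open CommutativeSemigroupProperties *-commutativeSemigroup using (x∙yz≈y∙xz)
  open CommutativeSemigroupProperties +-commutativeSemigroup using (interchange)

  -- Finite sums

  sumF-cong : ∀ m {f g : Fin m → Carrier} → (∀ i → f i ≈ g i) → sumF f ≈ sumF g
  sumF-cong zero    eq = refl
  sumF-cong (suc m) eq = +-cong (eq zero) (sumF-cong m (eq ∘ suc))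

  sumF-zero : ∀ m {f : Fin m → Carrier} → (∀ i → f i ≈ 0#) → sumF f ≈ 0#
  sumF-zero zero    eq = refl
  sumF-zero (suc m) eq = trans (+-cong (eq zero) (sumF-zero m (eq ∘ suc))) (+-identityˡ 0#)

  sumF-+ : ∀ m (f g : Fin m → Carrier) → sumF (λ i → f i + g i) ≈ sumF f + sumF g
  sumF-+ zero    f g = sym (+-identityˡ 0#)
  sumF-+ (suc m) f g = trans (+-congˡ (sumF-+ m (f ∘ suc) (g ∘ suc))) (interchange _ _ _ _)

  *-sumF : ∀ m x (f : Fin m → Carrier) → x * sumF f ≈ sumF (λ i → x * f i)
  *-sumF zero    x f = zeroʳ x
  *-sumF (suc m) x f = trans (distribˡ _ _ _) (+-congˡ (*-sumF m x (f ∘ suc)))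

  sumF-* : ∀ m x (f : Fin m → Carrier) → sumF f * x ≈ sumF (λ i → f i * x)
  sumF-* zero    x f = zeroˡ x
  sumF-* (suc m) x f = trans (distribʳ _ _ _) (+-congˡ (sumF-* m x (f ∘ suc)))

  sumF-comm : ∀ l m (f : Fin l → Fin m → Carrier) →
    sumF (λ i → sumF (f i)) ≈ sumF (λ j → sumF (λ i → f i j))
  sumF-comm zero    m f = sym (sumF-zero m (λ _ → refl))
  sumF-comm (suc l) m f = trans (+-congˡ (sumF-comm l m (f ∘ suc))) (sym (sumF-+ m (f zero) _))

  sumF-single : ∀ {m} (i : Fin m) {f : Fin m → Carrier} → (∀ k → k ≢ i → f k ≈ 0#) → sumF f ≈ f i
  sumF-single zero    eq = trans (+-congˡ (sumF-zero _ (λ k → eq (suc k) λ ()))) (+-identityʳ _)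
  sumF-single (suc i) eq = trans
    (+-cong (eq zero λ ()) (sumF-single i (λ k k≢i → eq (suc k) (k≢i ∘ Fin.suc-injective))))
    (+-identityˡ _)

  -- The ring homomorphism from ℤ to R

  natR-+ : ∀ a b → natR (a ℕ.+ b) ≈ natR a + natR b
  natR-+ zero    b = sym (+-identityˡ _)
  natR-+ (suc a) b = trans (+-congˡ (natR-+ a b)) (sym (+-assoc _ _ _))

  natR-* : ∀ a b → natR (a ℕ.* b) ≈ natR a * natR b
  natR-* zero    b = sym (zeroˡ _)
  natR-* (suc a) b = begin
    natR (b ℕ.+ a ℕ.* b)              ≈⟨ natR-+ b (a ℕ.* b) ⟩
    natR b + natR (a ℕ.* b)           ≈⟨ +-cong (sym (*-identityˡ _)) (natR-* a b) ⟩
    1# * natR b + natR a * natR b     ≈⟨ distribʳ _ _ _ ⟨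
    (1# + natR a) * natR b            ∎

  fromℤ-neg : ∀ i → fromℤ (ℤ.- i) ≈ - fromℤ i
  fromℤ-neg (+ zero)  = sym -0#≈0#
  fromℤ-neg (+ suc k) = refl
  fromℤ-neg -[1+ k ]  = sym (-‿involutive _)

  fromℤ-⊖ : ∀ a b → fromℤ (a ℤ.⊖ b) ≈ natR a - natR b
  fromℤ-⊖ a       zero    = trans (sym (+-identityʳ _)) (+-congˡ (sym -0#≈0#))
  fromℤ-⊖ zero    (suc b) = sym (+-identityˡ _)
  fromℤ-⊖ (suc a) (suc b) = begin
    fromℤ (suc a ℤ.⊖ suc b)              ≡⟨ ≡.cong fromℤ (ℤ.[1+m]⊖[1+n]≡m⊖n a b) ⟩
    fromℤ (a ℤ.⊖ b)                      ≈⟨ fromℤ-⊖ a b ⟩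
    natR a - natR b                      ≈⟨ +-identityˡ _ ⟨
    0# + (natR a - natR b)               ≈⟨ +-congʳ (-‿inverseʳ 1#) ⟨
    (1# - 1#) + (natR a - natR b)        ≈⟨ interchange _ _ _ _ ⟩
    (1# + natR a) + (- 1# + - natR b)    ≈⟨ +-congˡ (-‿+-comm _ _) ⟩
    (1# + natR a) - (1# + natR b)        ∎

  fromℤ-+ : ∀ i j → fromℤ (i ℤ.+ j) ≈ fromℤ i + fromℤ j
  fromℤ-+ (+ a)    (+ b)    = natR-+ a b
  fromℤ-+ (+ a)    -[1+ b ] = fromℤ-⊖ a (suc b)
  fromℤ-+ -[1+ a ] (+ b)    = trans (fromℤ-⊖ b (suc a)) (+-comm _ _)
  fromℤ-+ -[1+ a ] -[1+ b ] = begin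
    - natR (suc (suc (a ℕ.+ b)))   ≈⟨ -‿cong (trans (sym (+-assoc _ _ _)) (trans (+-congˡ (natR-+ a b)) (interchange _ _ _ _))) ⟩
    - (natR (suc a) + natR (suc b))  ≈⟨ -‿+-comm _ _ ⟨
    - natR (suc a) - natR (suc b)    ∎

  fromℤ-* : ∀ i j → fromℤ (i ℤ.* j) ≈ fromℤ i * fromℤ j
  fromℤ-* (+ a) (+ b) = trans (reflexive (≡.cong fromℤ (ℤ.+◃n≡+n (a ℕ.* b)))) (natR-* a b)
  fromℤ-* (+ a) -[1+ b ] = begin
    fromℤ (Sign.- ℤ.◃ (a ℕ.* suc b))  ≡⟨ ≡.cong fromℤ (ℤ.-◃n≡-n (a ℕ.* suc b)) ⟩
    fromℤ (ℤ.- (+ (a ℕ.* suc b)))     ≈⟨ fromℤ-neg (+ (a ℕ.* suc b)) ⟩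
    - natR (a ℕ.* suc b)              ≈⟨ -‿cong (natR-* a (suc b)) ⟩
    - (natR a * natR (suc b))         ≈⟨ -‿distribʳ-* _ _ ⟩
    natR a * - natR (suc b)           ∎
  fromℤ-* -[1+ a ] (+ b) = begin
    fromℤ (Sign.- ℤ.◃ (suc a ℕ.* b))  ≡⟨ ≡.cong fromℤ (ℤ.-◃n≡-n (suc a ℕ.* b)) ⟩
    fromℤ (ℤ.- (+ (suc a ℕ.* b)))     ≈⟨ fromℤ-neg (+ (suc a ℕ.* b)) ⟩
    - natR (suc a ℕ.* b)              ≈⟨ -‿cong (natR-* (suc a) b) ⟩
    - (natR (suc a) * natR b)         ≈⟨ -‿distribˡ-* _ _ ⟩
    - natR (suc a) * natR b           ∎
  fromℤ-* -[1+ a ] -[1+ b ] = begin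
    natR (suc a ℕ.* suc b)              ≈⟨ natR-* (suc a) (suc b) ⟩
    natR (suc a) * natR (suc b)         ≈⟨ -‿involutive _ ⟨
    - - (natR (suc a) * natR (suc b))   ≈⟨ -‿cong (-‿distribʳ-* _ _) ⟩
    - (natR (suc a) * - natR (suc b))   ≈⟨ -‿distribˡ-* _ _ ⟩
    - natR (suc a) * - natR (suc b)     ∎

  -- Carries the normalisation e* e = 1 from ℤ to R.
  fromℤ-pair : ∀ {m} (l v : Fin m → ℤ) → fromℤ (pairℤ l v) ≈ sumF (λ i → fromℤ (l i) * fromℤ (v i))
  fromℤ-pair {zero}  l v = refl
  fromℤ-pair {suc m} l v = trans (fromℤ-+ (l zero ℤ.* v zero) _)
    (+-cong (fromℤ-* (l zero) (v zero)) (fromℤ-pair (l ∘ suc) (v ∘ suc)))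

  -- Pairings of rows with columns

  dot : Vec → Vec → Carrier
  dot l v = sumF (λ k → l k * v k)

  dot-cong : ∀ {l l' v v'} → l ≈V l' → v ≈V v' → dot l v ≈ dot l' v'
  dot-cong l≈ v≈ = sumF-cong n (λ k → *-cong (l≈ k) (v≈ k))

  -- An interchange of two sums. Associativity of matrices is the instance at a row of the first and
  -- a column of the third factor.
  dot-assoc : ∀ l A v → dot (l ▹ A) v ≈ dot l (A ◃ v)
  dot-assoc l A v = begin
    sumF (λ k → sumF (λ i → l i * A i k) * v k)    ≈⟨ sumF-cong n (λ k → sumF-* n (v k) _) ⟩
    sumF (λ k → sumF (λ i → (l i * A i k) * v k))  ≈⟨ sumF-comm n n _ ⟩
    sumF (λ i → sumF (λ k → (l i * A i k) * v k))  ≈⟨ sumF-cong n (λ i → sumF-cong n (λ k → *-assoc _ _ _)) ⟩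
    sumF (λ i → sumF (λ k → l i * (A i k * v k)))  ≈⟨ sumF-cong n (λ i → *-sumF n (l i) _) ⟨
    sumF (λ i → l i * sumF (λ k → A i k * v k))    ∎

  δ-diag : ∀ i → δ i i ≈ 1#
  δ-diag i with i Fin.≟ i
  ... | yes _   = refl
  ... | no  i≢i = contradiction ≡.refl i≢i

  δ-off : ∀ {i j} → i ≢ j → δ i j ≈ 0#
  δ-off {i} {j} i≢j with i Fin.≟ j
  ... | yes i≡j = contradiction i≡j i≢j
  ... | no  _   = refl

  dot-δˡ : ∀ i v → dot (δ i) v ≈ v i
  dot-δˡ i v = trans
    (sumF-single i (λ k k≢i → trans (*-congʳ (δ-off (k≢i ∘ ≡.sym))) (zeroˡ _)))
    (trans (*-congʳ (δ-diag i)) (*-identityˡ _))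

  dot-δʳ : ∀ l j → dot l (λ k → δ k j) ≈ l j
  dot-δʳ l j = trans
    (sumF-single j (λ k k≢j → trans (*-congˡ (δ-off k≢j)) (zeroʳ _)))
    (trans (*-congˡ (δ-diag j)) (*-identityʳ _))

  dot-*ˡ : ∀ r l v → dot (λ k → r * l k) v ≈ r * dot l v
  dot-*ˡ r l v = trans (sumF-cong n (λ k → *-assoc r (l k) (v k))) (sym (*-sumF n r _))

  dot-*ʳ : ∀ r l v → dot l (λ k → v k * r) ≈ dot l v * r
  dot-*ʳ r l v = trans (sumF-cong n (λ k → sym (*-assoc (l k) (v k) r))) (sym (sumF-* n r _))

  -- The ring of matrices and its scalars

  matrixRing : Ring c ℓ
  matrixRing = record
    { Carrier = Mat ; _≈_ = _≈M_ ; _+_ = _⊕_ ; _*_ = _·_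
    ; -_ = λ A i j → - A i j ; 0# = 0M ; 1# = I
    ; isRing = record
      { +-isAbelianGroup = record
        { isGroup = record
          { isMonoid = record
            { isSemigroup = record
              { isMagma = record
                { isEquivalence = record
                  { refl  = λ i j → refl
                  ; sym   = λ eq i j → sym (eq i j)
                  ; trans = λ eq eq' i j → trans (eq i j) (eq' i j)
                  }
                ; ∙-cong = λ eq eq' i j → +-cong (eq i j) (eq' i j)
                }
              ; assoc = λ A B C i j → +-assoc _ _ _
              }
            ; identity = (λ A i j → +-identityˡ _) , (λ A i j → +-identityʳ _)
            }
          ; inverse = (λ A i j → -‿inverseˡ _) , (λ A i j → -‿inverseʳ _)
          ; ⁻¹-cong = λ eq i j → -‿cong (eq i j)
          }
        ; comm = λ A B i j → +-comm _ _
        }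
      ; *-cong = λ eq eq' i j → dot-cong (eq i) (λ k → eq' k j)
      ; *-assoc = λ A B C i j → dot-assoc (A i) B (λ k → C k j)
      ; *-identity = (λ A i j → dot-δˡ i (λ k → A k j)) , (λ A i j → dot-δʳ (A i) j)
      ; distrib = (λ A B C i j → trans (sumF-cong n (λ k → distribˡ _ _ _)) (sumF-+ n _ _))
                , (λ A B C i j → trans (sumF-cong n (λ k → distribʳ _ _ _)) (sumF-+ n _ _))
      }
    }

  module 𝕄 = Ring matrixRing

  p : Mat
  p = outer eR e*R

  ◃-congˡ : ∀ {A v w} → v ≈V w → (A ◃ v) ≈V (A ◃ w)
  ◃-congˡ eq i = dot-cong (λ _ → refl) eq

  I◃ : ∀ v → (I ◃ v) ≈V v
  I◃ v i = dot-δˡ i v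

  ▹I : ∀ l → (l ▹ I) ≈V l
  ▹I l j = dot-δʳ l j

  0◃ : ∀ v i → (0M ◃ v) i ≈ 0#
  0◃ v i = sumF-zero n (λ k → zeroˡ _)

  ▹0 : ∀ l j → (l ▹ 0M) j ≈ 0#
  ▹0 l j = sumF-zero n (λ k → zeroʳ _)

  ·-outer : ∀ A v l → (A · outer v l) ≈M outer (A ◃ v) l
  ·-outer A v l i j = dot-*ʳ (l j) (A i) v

  outer-· : ∀ A v l → (outer v l · A) ≈M outer v (l ▹ A)
  outer-· A v l i j = dot-*ˡ (v i) l (λ k → A k j)

  scal-· : ∀ r A i j → (scal r · A) i j ≈ r * A i j
  scal-· r A i j = trans (dot-*ˡ r (δ i) (λ k → A k j)) (*-congˡ (dot-δˡ i (λ k → A k j)))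

  ·-scal : ∀ r A i j → (A · scal r) i j ≈ r * A i j
  ·-scal r A i j = begin
    sumF (λ k → A i k * (r * δ k j))  ≈⟨ sumF-cong n (λ k → x∙yz≈y∙xz _ _ _) ⟩
    sumF (λ k → r * (A i k * δ k j))  ≈⟨ *-sumF n r _ ⟨
    r * dot (A i) (λ k → δ k j)       ≈⟨ *-congˡ (dot-δʳ (A i) j) ⟩
    r * A i j                         ∎

  -- Unlike in `IsZ`, r may be a non-unit, as coefficients of polynomials must be arbitrary.
  IsScalar : Mat → Set (c ⊔ ℓ)
  IsScalar A = Σ Carrier λ r → A ≈M scal r

  scalar-central : ∀ {A} → IsScalar A → ∀ B → (A · B) ≈M (B · A)
  scalar-central {A} (r , eq) B i j = begin
    (A · B) i j       ≈⟨ 𝕄.*-congʳ {B} {A} {scal r} eq i j ⟩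
    (scal r · B) i j  ≈⟨ scal-· r B i j ⟩
    r * B i j         ≈⟨ ·-scal r B i j ⟨
    (B · scal r) i j  ≈⟨ 𝕄.*-congˡ {B} {A} {scal r} eq i j ⟨
    (B · A) i j       ∎

  scalar-0 : IsScalar 0M
  scalar-0 = 0# , λ i j → sym (zeroˡ _)

  scalar-+ : ∀ {A B} → IsScalar A → IsScalar B → IsScalar (A ⊕ B)
  scalar-+ (r , eq) (s , eq') = r + s , λ i j → trans (+-cong (eq i j) (eq' i j)) (sym (distribʳ _ _ _))

  scalar-* : ∀ {A B} → IsScalar A → IsScalar B → IsScalar (A · B)
  scalar-* {A} {B} (r , eq) (s , eq') = r * s , λ i j → begin
    (A · B) i j            ≈⟨ 𝕄.*-cong {A} {scal r} {B} {scal s} eq eq' i j ⟩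
    (scal r · scal s) i j  ≈⟨ scal-· r (scal s) i j ⟩
    r * (s * δ i j)        ≈⟨ *-assoc _ _ _ ⟨
    (r * s) * δ i j        ∎

  open Polynomials matrixRing IsScalar scalar-central

  evalPoly-poly : ∀ τ rs → Poly τ (evalPoly rs τ)
  evalPoly-poly τ []       = nil (λ i j → refl)
  evalPoly-poly τ (r ∷ rs) = step {z = scal r} (r , λ i j → refl) (evalPoly-poly τ rs) (λ i j → refl)

  -- Translation of vectors and covectors into multiples of `p`

  module Normalised (e*e : pairℤ e* e ≡ + 1) where

    e*e≈1 : dot e*R eR ≈ 1#
    e*e≈1 = begin
      dot e*R eR             ≈⟨ fromℤ-pair e* e ⟨
      fromℤ (pairℤ e* e)     ≡⟨ ≡.cong fromℤ e*e ⟩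
      1# + 0#                ≈⟨ +-identityʳ 1# ⟩
      1#                     ∎

    outer-e : ∀ v → (outer v e*R ◃ eR) ≈V v
    outer-e v i = trans (dot-*ˡ (v i) e*R eR) (trans (*-congˡ e*e≈1) (*-identityʳ _))

    e*-outer : ∀ l → (e*R ▹ outer eR l) ≈V l
    e*-outer l j = trans (dot-*ʳ (l j) e*R eR) (trans (*-congʳ e*e≈1) (*-identityˡ _))

    e⇒p : ∀ {A B} → (A ◃ eR) ≈V (B ◃ eR) → (A · p) ≈M (B · p)
    e⇒p {A} {B} eq i j = begin
      (A · p) i j             ≈⟨ ·-outer A eR e*R i j ⟩
      (A ◃ eR) i * e*R j      ≈⟨ *-congʳ (eq i) ⟩
      (B ◃ eR) i * e*R j      ≈⟨ ·-outer B eR e*R i j ⟨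
      (B · p) i j             ∎

    e*⇒p : ∀ {A B} → (e*R ▹ A) ≈V (e*R ▹ B) → (p · A) ≈M (p · B)
    e*⇒p {A} {B} eq i j = begin
      (p · A) i j             ≈⟨ outer-· A eR e*R i j ⟩
      eR i * (e*R ▹ A) j      ≈⟨ *-congˡ (eq j) ⟩
      eR i * (e*R ▹ B) j      ≈⟨ outer-· B eR e*R i j ⟨
      (p · B) i j             ∎

    -- Because e* e = 1, `p` fixes e, and A e is recovered as A p e.
    p⇒e : ∀ {A B} → (A · p) ≈M (B · p) → (A ◃ eR) ≈V (B ◃ eR)
    p⇒e {A} {B} eq i = begin
      (A ◃ eR) i                      ≈⟨ ◃-congˡ {A} (outer-e eR) i ⟨
      (A ◃ (p ◃ eR)) i                ≈⟨ dot-assoc (A i) p eR ⟨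
      ((A · p) ◃ eR) i                ≈⟨ dot-cong (eq i) (λ _ → refl) ⟩
      ((B · p) ◃ eR) i                ≈⟨ dot-assoc (B i) p eR ⟩
      (B ◃ (p ◃ eR)) i                ≈⟨ ◃-congˡ {B} (outer-e eR) i ⟩
      (B ◃ eR) i                      ∎

    p⇒e* : ∀ {A B} → (p · A) ≈M (p · B) → (e*R ▹ A) ≈V (e*R ▹ B)
    p⇒e* {A} {B} eq j = begin
      (e*R ▹ A) j               ≈⟨ dot-cong (e*-outer e*R) (λ _ → refl) ⟨
      ((e*R ▹ p) ▹ A) j         ≈⟨ dot-assoc e*R p (λ k → A k j) ⟩
      (e*R ▹ (p · A)) j         ≈⟨ dot-cong (λ _ → refl) (λ k → eq k j) ⟩
      (e*R ▹ (p · B)) j         ≈⟨ dot-assoc e*R p (λ k → B k j) ⟨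
      ((e*R ▹ p) ▹ B) j         ≈⟨ dot-cong (e*-outer e*R) (λ _ → refl) ⟩
      (e*R ▹ B) j               ∎

    fixes-e⇒p : ∀ {A} → (A ◃ eR) ≈V eR → (A · p) ≈M p
    fixes-e⇒p {A} eq i j = trans (e⇒p {A} {I} (λ k → trans (eq k) (sym (I◃ eR k))) i j) (𝕄.*-identityˡ p i j)

    fixes-e*⇒p : ∀ {A} → (e*R ▹ A) ≈V e*R → (p · A) ≈M p
    fixes-e*⇒p {A} eq i j = trans (e*⇒p {A} {I} (λ k → trans (eq k) (sym (▹I e*R k))) i j) (𝕄.*-identityʳ p i j)

    kills-e⇒p : ∀ {A} → (∀ i → (A ◃ eR) i ≈ 0#) → (A · p) ≈M 0M
    kills-e⇒p {A} eq i j = trans (e⇒p {A} {0M} (λ k → trans (eq k) (sym (0◃ eR k))) i j) (𝕄.zeroˡ p i j)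

    kills-e*⇒p : ∀ {A} → (∀ j → (e*R ▹ A) j ≈ 0#) → (p · A) ≈M 0M
    kills-e*⇒p {A} eq i j = trans (e*⇒p {A} {0M} (λ k → trans (eq k) (sym (▹0 e*R k))) i j) (𝕄.zeroʳ p i j)

    p⇒kills-e : ∀ {A} → (A · p) ≈M 0M → ∀ i → (A ◃ eR) i ≈ 0#
    p⇒kills-e {A} eq i = trans (p⇒e {A} {0M} (λ j k → trans (eq j k) (sym (𝕄.zeroˡ p j k))) i) (0◃ eR i)

    p⇒kills-e* : ∀ {A} → (p · A) ≈M 0M → ∀ j → (e*R ▹ A) j ≈ 0#
    p⇒kills-e* {A} eq i = trans (p⇒e* {A} {0M} (λ j k → trans (eq j k) (sym (𝕄.zeroʳ p j k))) i) (▹0 e*R i)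

    pp : (p · p) ≈M p
    pp = fixes-e⇒p {p} (outer-e eR)

    corner : ∀ A → Σ Mat λ z → IsScalar z × (p · (A · p)) ≈M (z · p)
    corner A = scal r , (r , λ i j → refl) , λ i j → begin
      (p · (A · p)) i j                    ≈⟨ outer-· (A · p) eR e*R i j ⟩
      eR i * (e*R ▹ (A · p)) j             ≈⟨ *-congˡ (dot-assoc e*R A (λ k → p k j)) ⟨
      eR i * ((e*R ▹ A) ▹ p) j             ≈⟨ *-congˡ (dot-*ʳ (e*R j) (e*R ▹ A) eR) ⟩
      eR i * (r * e*R j)                   ≈⟨ x∙yz≈y∙xz _ _ _ ⟩
      r * p i j                            ≈⟨ scal-· r p i j ⟨
      (scal r · p) i j                     ∎
      where
      r : Carrier
      r = dot (e*R ▹ A) eR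

    -- The test matrix W sends e to the j-th basis vector, so the hypothesis at W compares the j-th
    -- columns.
    faithfulˡ : ∀ {A B} → (∀ W → (A · (W · p)) ≈M (B · (W · p))) → A ≈M B
    faithfulˡ {A} {B} eq i j = begin
      A i j                        ≈⟨ column A ⟩
      ((A · W) ◃ eR) i             ≈⟨ p⇒e {A · W} {B · W} (λ k l →
          trans (𝕄.*-assoc A W p k l) (trans (eq W k l) (sym (𝕄.*-assoc B W p k l)))) i ⟩
      ((B · W) ◃ eR) i             ≈⟨ column B ⟨
      B i j                        ∎
      where
      W : Mat
      W = outer (λ k → δ k j) e*R
      column : ∀ X → X i j ≈ ((X · W) ◃ eR) i
      column X = begin
        X i j                      ≈⟨ dot-δʳ (X i) j ⟨
        (X ◃ (λ k → δ k j)) i      ≈⟨ ◃-congˡ {X} (outer-e (λ k → δ k j)) i ⟨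
        (X ◃ (W ◃ eR)) i           ≈⟨ dot-assoc (X i) W eR ⟨
        ((X · W) ◃ eR) i           ∎

    faithfulʳ : ∀ {A B} → (∀ W → ((p · W) · A) ≈M ((p · W) · B)) → A ≈M B
    faithfulʳ {A} {B} eq i j = begin
      A i j                        ≈⟨ row A ⟩
      (e*R ▹ (W · A)) j            ≈⟨ p⇒e* {W · A} {W · B} (λ k l →
          trans (sym (𝕄.*-assoc p W A k l)) (trans (eq W k l) (𝕄.*-assoc p W B k l))) j ⟩
      (e*R ▹ (W · B)) j            ≈⟨ row B ⟨
      B i j                        ∎
      where
      W : Mat
      W = outer eR (δ i)
      row : ∀ X → X i j ≈ (e*R ▹ (W · X)) j
      row X = begin
        X i j                      ≈⟨ dot-δˡ i (λ k → X k j) ⟨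
        (δ i ▹ X) j                ≈⟨ dot-cong (e*-outer (δ i)) (λ _ → refl) ⟨
        ((e*R ▹ W) ▹ X) j          ≈⟨ dot-assoc e*R W (λ k → X k j) ⟩
        (e*R ▹ (W · X)) j          ∎

    -- Evaluating r A = 1 between e* and e gives r (e* A e) = 1.
    scalar-unit : ∀ {r A} → (scal r · A) ≈M I → Σ Carrier λ r' → r * r' ≈ 1#
    scalar-unit {r} {A} eq = dot e*R (A ◃ eR) , (begin
      r * dot e*R (A ◃ eR)              ≈⟨ *-sumF n r _ ⟩
      sumF (λ i → r * (e*R i * (A ◃ eR) i))  ≈⟨ sumF-cong n (λ i → x∙yz≈y∙xz _ _ _) ⟩
      sumF (λ i → e*R i * (r * (A ◃ eR) i))  ≈⟨ sumF-cong n (λ i → *-congˡ (trans (dot-cong (scal-· r A i) (λ _ → refl)) (dot-*ˡ r (A i) eR))) ⟨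
      dot e*R ((scal r · A) ◃ eR)       ≈⟨ dot-cong (λ _ → refl) (λ i → trans (dot-cong (eq i) (λ _ → refl)) (I◃ eR i)) ⟩
      dot e*R eR                        ≈⟨ e*e≈1 ⟩
      1#                                ∎)

-- Matrices over the dual numbers, as pairs of matrices over R

module DualMatrices {c ℓ} (R : CommutativeRing c ℓ) (n : ℕ) (e e* : Fin n → ℤ) where
  open CommutativeRing R hiding (zero)
  open RingProperties ring using (-0#≈0#)
  open Tangent R n e e*
  open Matrices R n e e*
  open RingLemmas matrixRing using (IsInverse; dual-inverse)
  open SetoidReasoning setoid

  open Lin (Dual rawRing) n e e* using () renaming (Mat to Matᴰ; Vec to Vecᴰ)

  ∂ : Matᴰ → Mat
  ∂ A i j = proj₂ (A i j)

  infix 6 _+ε_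
  _+ε_ : Mat → Mat → Matᴰ
  (A +ε B) i j = A i j , B i j

  -- Components of sums and products over the dual numbers

  proj₁-sumF : ∀ m (f : Fin m → Carrier × Carrier) → proj₁ (D.sumF f) ≈ sumF (proj₁ ∘ f)
  proj₁-sumF zero    f = refl
  proj₁-sumF (suc m) f = +-congˡ (proj₁-sumF m (f ∘ suc))

  proj₂-sumF : ∀ m (f : Fin m → Carrier × Carrier) → proj₂ (D.sumF f) ≈ sumF (proj₂ ∘ f)
  proj₂-sumF zero    f = refl
  proj₂-sumF (suc m) f = +-congˡ (proj₂-sumF m (f ∘ suc))

  -- The product of dual numbers is written out under the sum, so that entries of all products over
  -- R[ε] are instances of it by computation.
  dotᴰ : Vecᴰ → Vecᴰ → Carrier × Carrier
  dotᴰ l v = D.sumF (λ k → (proj₁ (l k) * proj₁ (v k)) , (proj₁ (l k) * proj₂ (v k) + proj₂ (l k) * proj₁ (v k)))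

  proj₁-dot : ∀ l v → proj₁ (dotᴰ l v) ≈ dot (proj₁ ∘ l) (proj₁ ∘ v)
  proj₁-dot l v = proj₁-sumF n _

  proj₂-dot : ∀ l v → proj₂ (dotᴰ l v) ≈ dot (proj₁ ∘ l) (proj₂ ∘ v) + dot (proj₂ ∘ l) (proj₁ ∘ v)
  proj₂-dot l v = trans (proj₂-sumF n _) (sumF-+ n _ _)

  π-· : ∀ A B → π (A D.· B) ≈M (π A · π B)
  π-· A B i j = proj₁-dot (A i) (λ k → B k j)

  ∂-· : ∀ A B → ∂ (A D.· B) ≈M ((π A · ∂ B) ⊕ (∂ A · π B))
  ∂-· A B i j = proj₂-dot (A i) (λ k → B k j)

  π-I : π D.I ≈M I
  π-I i j with i Fin.≟ j
  ... | yes _ = refl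
  ... | no  _ = refl

  ∂-I : ∂ D.I ≈M 0M
  ∂-I i j with i Fin.≟ j
  ... | yes _ = refl
  ... | no  _ = refl

  proj₁-natR : ∀ k → proj₁ (D.natR k) ≈ natR k
  proj₁-natR zero    = refl
  proj₁-natR (suc k) = +-congˡ (proj₁-natR k)

  proj₂-natR : ∀ k → proj₂ (D.natR k) ≈ 0#
  proj₂-natR zero    = refl
  proj₂-natR (suc k) = trans (+-identityˡ _) (proj₂-natR k)

  proj₁-fromℤ : ∀ z → proj₁ (D.fromℤ z) ≈ fromℤ z
  proj₁-fromℤ (+ k)    = proj₁-natR k
  proj₁-fromℤ -[1+ k ] = -‿cong (proj₁-natR (suc k))

  proj₂-fromℤ : ∀ z → proj₂ (D.fromℤ z) ≈ 0#
  proj₂-fromℤ (+ k)    = proj₂-natR k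
  proj₂-fromℤ -[1+ k ] = trans (-‿cong (proj₂-natR (suc k))) -0#≈0#

  dot-0ˡ : ∀ {l} v → (∀ k → l k ≈ 0#) → dot l v ≈ 0#
  dot-0ˡ v eq = sumF-zero n (λ k → trans (*-congʳ (eq k)) (zeroˡ _))

  dot-0ʳ : ∀ l {v} → (∀ k → v k ≈ 0#) → dot l v ≈ 0#
  dot-0ʳ l eq = sumF-zero n (λ k → trans (*-congˡ (eq k)) (zeroʳ _))

  π-◃ : ∀ A i → proj₁ ((A D.◃ D.eR) i) ≈ (π A ◃ eR) i
  π-◃ A i = trans (proj₁-dot (A i) D.eR) (dot-cong (λ _ → refl) (λ k → proj₁-fromℤ (e k)))

  ∂-◃ : ∀ A i → proj₂ ((A D.◃ D.eR) i) ≈ (∂ A ◃ eR) i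
  ∂-◃ A i = trans (proj₂-dot (A i) D.eR) (trans
    (+-cong (dot-0ʳ (π A i) (λ k → proj₂-fromℤ (e k))) (dot-cong (λ _ → refl) (λ k → proj₁-fromℤ (e k))))
    (+-identityˡ _))

  π-▹ : ∀ A j → proj₁ ((D.e*R D.▹ A) j) ≈ (e*R ▹ π A) j
  π-▹ A j = trans (proj₁-dot D.e*R (λ k → A k j)) (dot-cong (λ k → proj₁-fromℤ (e* k)) (λ _ → refl))

  ∂-▹ : ∀ A j → proj₂ ((D.e*R D.▹ A) j) ≈ (e*R ▹ ∂ A) j
  ∂-▹ A j = trans (proj₂-dot D.e*R (λ k → A k j)) (trans
    (+-cong (dot-cong (λ k → proj₁-fromℤ (e* k)) (λ _ → refl)) (dot-0ˡ (λ k → π A k j) (λ k → proj₂-fromℤ (e* k))))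
    (+-identityʳ _))

  -- Over R[ε] both `ι (τH τ)` and `D.τH (ι τ)` occur. They agree only up to `≈`, and this relation
  -- lets either stand for `τH τ`.
  record ConstantLift (A : Mat) (A' : Matᴰ) : Set ℓ where
    constructor _,_
    field
      π≈ : π A' ≈M A
      ∂≈0 : ∂ A' ≈M 0M

  ι-lift : ∀ A → ConstantLift A (ι A)
  ι-lift A = (λ i j → refl) , (λ i j → refl)

  ·-lift : ∀ {A B A' B'} → ConstantLift A A' → ConstantLift B B' → ConstantLift (A · B) (A' D.· B')
  ·-lift {A} {B} {A'} {B'} (πA , ∂A) (πB , ∂B) =
    (λ i j → trans (π-· A' B' i j) (dot-cong (πA i) (λ k → πB k j))) ,
    (λ i j → trans (∂-· A' B' i j) (trans
      (+-cong (dot-0ʳ (π A' i) (λ k → ∂B k j)) (dot-0ˡ (λ k → π B' k j) (∂A i))) (+-identityˡ _)))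

  1H-lift : ConstantLift 1H D.1H
  1H-lift =
    (λ i j → +-cong (π-I i j) (-‿cong (*-cong (proj₁-fromℤ (e i)) (proj₁-fromℤ (e* j))))) ,
    (λ i j → trans (+-cong (∂-I i j) (-‿cong (trans (+-cong
      (trans (*-congˡ (proj₂-fromℤ (e* j))) (zeroʳ _))
      (trans (*-congʳ (proj₂-fromℤ (e i))) (zeroˡ _))) (+-identityˡ _)))) (trans (+-identityˡ _) -0#≈0#))

  τH-lift : ∀ τ → ConstantLift (τH τ) (D.τH (ι τ))
  τH-lift τ = ·-lift {1H} {τ · 1H} 1H-lift (·-lift {τ} {1H} (ι-lift τ) 1H-lift)

  lift-·ˡ : ∀ {A A'} B → ConstantLift A A' → π (A' D.· B) ≈M (A · π B) × ∂ (A' D.· B) ≈M (A · ∂ B)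
  lift-·ˡ {A} {A'} B (πA , ∂A) =
    (λ i j → trans (π-· A' B i j) (dot-cong (πA i) (λ _ → refl))) ,
    (λ i j → trans (∂-· A' B i j) (trans
      (+-cong (dot-cong (πA i) (λ _ → refl)) (dot-0ˡ (λ k → π B k j) (∂A i))) (+-identityʳ _)))

  lift-·ʳ : ∀ {A A'} B → ConstantLift A A' → π (B D.· A') ≈M (π B · A) × ∂ (B D.· A') ≈M (∂ B · A)
  lift-·ʳ {A} {A'} B (πA , ∂A) =
    (λ i j → trans (π-· B A' i j) (dot-cong (λ _ → refl) (λ k → πA k j))) ,
    (λ i j → trans (∂-· B A' i j) (trans
      (+-cong (dot-0ʳ (π B i) (λ k → ∂A k j)) (dot-cong (λ _ → refl) (λ k → πA k j))) (+-identityˡ _)))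

  module _ {σ σ'} (lift : ConstantLift σ σ') where

    -- As σ' has vanishing ε-part, the relation separates into one for each component.
    Commutes⁻ : ∀ {B} → D.Commutes σ' B → Commutes σ (π B) × Commutes σ (∂ B)
    Commutes⁻ {B} comm = let (l₁ , l₂) = lift-·ˡ B lift ; (r₁ , r₂) = lift-·ʳ B lift in
      (λ i j → trans (sym (r₁ i j)) (trans (proj₁ (comm i j)) (l₁ i j))) ,
      (λ i j → trans (sym (r₂ i j)) (trans (proj₂ (comm i j)) (l₂ i j)))

    Commutes⁺ : ∀ {B} → Commutes σ (π B) → Commutes σ (∂ B) → D.Commutes σ' B
    Commutes⁺ {B} comm₁ comm₂ i j = let (l₁ , l₂) = lift-·ˡ B lift ; (r₁ , r₂) = lift-·ʳ B lift in
      trans (r₁ i j) (trans (comm₁ i j) (sym (l₁ i j))) ,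
      trans (r₂ i j) (trans (comm₂ i j) (sym (l₂ i j)))

  -- The groups G and H over the dual numbers

  IsG⁻ : ∀ {A} → D.IsG A → IsG (π A)
  IsG⁻ {A} (A' , r , l) = π A' ,
    (λ i j → trans (sym (π-· A A' i j)) (trans (proj₁ (r i j)) (π-I i j))) ,
    (λ i j → trans (sym (π-· A' A i j)) (trans (proj₁ (l i j)) (π-I i j)))

  -- The inverse of g + ε d is g⁻¹ - ε g⁻¹ d g⁻¹; its ε-parts are checked by `dual-inverse`.
  IsG⁺ : ∀ {A} → IsG (π A) → D.IsG A
  IsG⁺ {A} (B , r , l) = A' ,
    (λ i j → trans (π-· A A' i j) (trans (r i j) (sym (π-I i j))) ,
             trans (∂-· A A' i j) (trans (proj₁ inv i j) (sym (∂-I i j)))) ,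
    (λ i j → trans (π-· A' A i j) (trans (l i j) (sym (π-I i j))) ,
             trans (∂-· A' A i j) (trans (proj₂ inv i j) (sym (∂-I i j))))
    where
    A' : Matᴰ
    A' = B +ε 𝕄.- (B · (∂ A · B))
    inv = dual-inverse {π A} {B} (r , l) (∂ A)

  module _ (e*e : pairℤ e* e ≡ + 1) where
    open Normalised e*e

    -- The vectors e and e* come from ℤ and have no ε-part, so fixing them means that the constant
    -- part fixes them and the ε-part annihilates them.
    IsH⁻ : ∀ {A} → D.IsH A → IsH (π A) × (∂ A · p) ≈M 0M × (p · ∂ A) ≈M 0M
    IsH⁻ {A} (gl , Ae , e*A) =
      ( IsG⁻ {A} gl
      , (λ i → trans (sym (π-◃ A i)) (trans (proj₁ (Ae i)) (proj₁-fromℤ (e i))))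
      , (λ j → trans (sym (π-▹ A j)) (trans (proj₁ (e*A j)) (proj₁-fromℤ (e* j)))) ) ,
      kills-e⇒p {∂ A} (λ i → trans (sym (∂-◃ A i)) (trans (proj₂ (Ae i)) (proj₂-fromℤ (e i)))) ,
      kills-e*⇒p {∂ A} (λ j → trans (sym (∂-▹ A j)) (trans (proj₂ (e*A j)) (proj₂-fromℤ (e* j))))

    IsH⁺ : ∀ {A} → IsH (π A) → (∂ A · p) ≈M 0M → (p · ∂ A) ≈M 0M → D.IsH A
    IsH⁺ {A} (gl , Ae , e*A) ∂p p∂ = IsG⁺ {A} gl ,
      (λ i → trans (π-◃ A i) (trans (Ae i) (sym (proj₁-fromℤ (e i)))) ,
             trans (∂-◃ A i) (trans (p⇒kills-e {∂ A} ∂p i) (sym (proj₂-fromℤ (e i))))) ,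
      (λ j → trans (π-▹ A j) (trans (e*A j) (sym (proj₁-fromℤ (e* j)))) ,
             trans (∂-▹ A j) (trans (p⇒kills-e* {∂ A} p∂ j) (sym (proj₂-fromℤ (e* j)))))

-- Transfer of the ring-theoretic criterion to matrices

theorem5p5 : ∀ {c ℓ : Level} (R : CommutativeRing c ℓ) (n : ℕ) (e e* : Fin n → ℤ) →
    pairℤ e* e ≡ + 1 →
    let open Tangent R n e e* in
    (τ a y : Mat) → Stable τ → IsG a → IsX τ a y →
    Σ Mat λ h → Σ Mat λ b →
    (IsH h × IsGτ τ b × (a · y) ≈M (h · b)) ×
    (∀ (h' b' : Mat) → IsH h' → IsGτ τ b' → (a · y) ≈M (h' · b') → h' ≈M h × b' ≈M b) ×
    (Tangential τ a y ⇔ IsZ (b · b))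
theorem5p5 R n e e* e*e τ a y (cyclic , cocyclic) _
  (((y-inv@(y⁻ , inv-y) , ye , e*y) , yσ) , h , b , Hh@((h⁻ , inv-h) , he , e*h) , Gb@((b⁻ , inv-b) , Cb) , ay) =
  h , b , (Hh , Gb , ay) , unique , mk⇔ tangential⇒scalar scalar⇒tangential
  where
  open CommutativeRing R using (refl; sym; trans; +-cong)
  open Tangent R n e e*
  open Matrices R n e e*
  open Normalised e*e
  open DualMatrices R n e e*

  stable : StableEndomorphism matrixRing _
  stable = record
    { K = IsScalar ; K-central = scalar-central ; K-0 = scalar-0
    ; K-+ = scalar-+ ; K-* = λ {A} {B} → scalar-* {A} {B}
    ; p = p ; pp = pp ; corner = corner
    ; faithfulˡ = λ {A} {B} → faithfulˡ {A} {B}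
    ; faithfulʳ = λ {A} {B} → faithfulʳ {A} {B}
    ; τ = τ
    ; cyclic = λ w → let (rs , eq) = cyclic (w ◃ eR) in
        evalPoly rs τ , evalPoly-poly τ rs , e⇒p {evalPoly rs τ} {w} eq
    ; cocyclic = λ w → let (rs , eq) = cocyclic (e*R ▹ w) in
        evalPoly rs τ , evalPoly-poly τ rs , e*⇒p {evalPoly rs τ} {w} eq
    }

  module E = StableElement stable

  module T = E.Tangency {b} {b⁻} Cb inv-b

  module F = T.Factorisation {a} {y} {y⁻} {h} {h⁻} inv-y (fixes-e⇒p {y} ye) (fixes-e*⇒p {y} e*y) yσ
    inv-h (fixes-e⇒p {h} he) (fixes-e*⇒p {h} e*h) ay

  unique : ∀ h' b' → IsH h' → IsGτ τ b' → (a · y) ≈M (h' · b') → h' ≈M h × b' ≈M b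
  unique h' b' ((h'⁻ , inv-h') , h'e , _) (_ , Cb') eq =
    E.factorisation-unique {h} {h'} {h'⁻} {b} {b⁻} {b'} (fixes-e⇒p {h} he) inv-h' (fixes-e⇒p {h'} h'e)
      inv-b Cb Cb' (λ i j → trans (sym (ay i j)) (eq i j))

  -- Tangentiality is applied to y + ε y₁. The constant parts of the resulting factors factorise a
  -- y, so by `unique` they are h and b; the ε-part is then the required equation.
  tangential⇒factors : Tangential τ a y → ∀ {y₁} → E.InLie y₁ → F.Factors y₁
  tangential⇒factors tangential {y₁} (y₁p , py₁ , y₁σ) =
    let y' = y +ε y₁
        (_ , h' , b' , Hh' , (Gb' , Cb') , ay') = tangential y'
          ( IsH⁺ e*e {y'} (y-inv , ye , e*y) y₁p py₁
          , Commutes⁺ (ι-lift (τH τ)) {y'} yσ y₁σ)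
          (λ i j → refl)
        (Hh₀ , h₁p , ph₁) = IsH⁻ e*e {h'} Hh'
        (Cb₀ , Cb₁) = Commutes⁻ (ι-lift τ) {b'} Cb'
        (πay , ∂ay) = lift-·ˡ y' (ι-lift a)
        (h₀≈h , b₀≈b) = unique (π h') (π b') Hh₀ (IsG⁻ {b'} Gb' , Cb₀)
          (λ i j → trans (sym (πay i j)) (trans (proj₁ (ay' i j)) (π-· h' b' i j)))
    in ∂ h' , ∂ b' , h₁p , ph₁ , Cb₁ , λ i j →
      trans (sym (∂ay i j)) (trans (proj₂ (ay' i j)) (trans (∂-· h' b' i j)
        (+-cong (dot-cong (h₀≈h i) (λ _ → refl)) (dot-cong (λ _ → refl) (λ k → b₀≈b k j)))))

  tangential⇒scalar : Tangential τ a y → IsZ (b · b)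
  tangential⇒scalar tangential =
    let (z , (r , z≈r) , bb≈z) = T.splits⇒square-scalar (F.factors⇒splits (tangential⇒factors tangential))
        bb≈r : (b · b) ≈M scal r
        bb≈r i j = trans (bb≈z i j) (z≈r i j)
    -- The scalar r is a unit because b⁻¹ b⁻¹ inverts b².
    in r , scalar-unit {r} {b⁻ · b⁻} (square-inverse bb≈r) , bb≈r
    where
    open SetoidReasoning 𝕄.setoid
    open RingLemmas matrixRing using (cancelˡ)
    square-inverse : ∀ {r} → (b · b) ≈M scal r → (scal r · (b⁻ · b⁻)) ≈M I
    square-inverse {r} bb≈r = begin
      scal r · (b⁻ · b⁻)     ≈⟨ 𝕄.*-congʳ {b⁻ · b⁻} {b · b} {scal r} bb≈r ⟨
      (b · b) · (b⁻ · b⁻)    ≈⟨ 𝕄.*-assoc b b _ ⟩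
      b · (b · (b⁻ · b⁻))    ≈⟨ 𝕄.*-congˡ {b} {b · (b⁻ · b⁻)} {b⁻} (cancelˡ {b⁻} {b} (proj₁ inv-b) b⁻) ⟩
      b · b⁻                 ≈⟨ proj₁ inv-b ⟩
      I                      ∎

  scalar⇒tangential : IsZ (b · b) → Tangential τ a y
  scalar⇒tangential (r , _ , bb≈r) y' (Hy' , y'σ) y₀≈y =
    let (_ , y₁p , py₁) = IsH⁻ e*e {y'} Hy'
        (y₀σ , y₁σ) = Commutes⁻ (ι-lift (τH τ)) {y'} y'σ
        (h₁ , b₁ , h₁p , ph₁ , Cb₁ , ay₁) = F.splits⇒factors
          (T.square-scalar⇒splits {scal r} (r , λ i j → refl) bb≈r) {∂ y'} (y₁p , py₁ , y₁σ)
        h' = h +ε h₁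
        b' = b +ε b₁
        (πay , ∂ay) = lift-·ˡ y' (ι-lift a)
    -- `Tangential` supplies commutation with `ι (τH τ)`, whereas `D.IsX` asks for it with
    -- `D.τH (ι τ)`; both lift `τH τ`, so the components serve for either.
    in (Hy' , Commutes⁺ (τH-lift τ) {y'} y₀σ y₁σ) , h' , b' ,
       IsH⁺ e*e {h'} Hh h₁p ph₁ ,
       (IsG⁺ {b'} (b⁻ , inv-b) , Commutes⁺ (ι-lift τ) {b'} Cb Cb₁) ,
       λ i j →
         trans (πay i j) (trans (dot-cong (λ _ → refl) (λ k → y₀≈y k j)) (trans (ay i j) (sym (π-· h' b' i j)))) ,
         trans (∂ay i j) (trans (ay₁ i j) (sym (∂-· h' b' i j)))
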